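{- For any integers $r\ge 1$ and $k\ge 2$, we have $\gamma^+(H_r^k)=\frac{r-1}{r}$, and $H_r^k$ is not $r$-colourable.
   Context: For an integer $k\ge 2$, a $k$-graph ($k$-uniform hypergraph) $H$ consists of a (finite) vertex set $V(H)$ and an edge set $E(H)\subseteq\binom{V(H)}{k}$. A $k$-graph is $F$-free if it contains no copy of $F$ as a (not necessarily induced) subgraph. For a $k$-graph $H$ with $E(H)\neq\emptyset$, the minimum positive codegree $\delta^+_{k-1}(H)$ is the minimum, over all $(k-1)$-subsets $S$ of $V(H)$ that are contained in at least one edge of $H$, of the number of edges of $H$ containing $S$; if $E(H)=\emptyset$ then $\delta^+_{k-1}(H):=0$. For a $k$-graph $F$, $\mathrm{ex}^+_{k-1}(n,F)$ is the maximum of $\delta^+_{k-1}(H)$ over all $n$-vertex $F$-free $k$-graphs $H$, and $\gamma^+(F):=\lim_{n\to\infty}\mathrm{ex}^+_{k-1}(n,F)/n$ (the limit is known to exist). For an integer $r\ge 1$, a $k$-graph is $r$-colourable if its vertices can be coloured with $r$ colours so that no edge is monochromatic. Construction $F(R,H)$: let $k\ge 3$, let $R$ be a $(k-1)$-graph and $H$ a $k$-graph. Let $X$ be a copy of $R$ (the core), and let $S_1,\dots,S_m$ be all the $(k-1)$-edges of $X$. Let $H_1,\dots,H_m$ be copies of $H$ such that $X,H_1,\dots,H_m$ are pairwise vertex-disjoint. Then $F(R,H)$ is the $k$-graph with vertex set $V(X)\cup\bigcup_{j=1}^m V(H_j)$ and edge set $\bigcup_{j=1}^m\{S_j\cup\{x\}: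 x\in V(H_j)\}\cup\bigcup_{j=1}^m E(H_j)$. The $k$-graphs $H_r^k$ are defined inductively for $r\ge1$, $k\ge2$: $H_1^k$ consists of a single $k$-edge (on $k$ vertices); $H_r^2:=K_{r+1}$ (the complete graph on $r+1$ vertices) for $r\ge 1$; and for $r\ge 2$ and $k\ge 3$, $H_r^k:=F(H_r^{k-1},H_{r-1}^k)$. -}

module Defs where

open import Data.Bool.Properties using () renaming (_≟_ to _≟ᵇ_)
open import Data.Empty using (⊥-elim)
open import Data.Fin using (Fin; zero; suc; _↑ˡ_; _↑ʳ_; combine; splitAt)
open import Data.Fin.Properties
  using (any?; suc-injective; ↑ˡ-injective; ↑ʳ-injective; combine-injectiveʳ; splitAt-↑ˡ; splitAt-↑ʳ)
open import Data.Fin.Subset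
  using (Subset; inside; outside; ⊥; ⊤; ⁅_⁆; _∈_; _∉_; _⊆_; _∪_; ∣_∣)
open import Data.Fin.Subset.Properties
  using (_⊆?_; anySubset?; ∣⊥∣≡0; ∣⊤∣≡n; ∪-identityˡ; x∈p∪q⁻; x∈⁅y⁆⇒x≡y; ∉⊥)
open import Data.Integer using (+_)
open import Data.List using (List; []; _∷_; _++_; map; filter; length; lookup)
open import Data.List.Extrema.Nat using (min)
open import Data.List.Membership.Propositional.Properties using (∈-lookup; ∈-filter⁻)
open import Data.List.Relation.Unary.Any using () renaming (any? to anyL?)
open import Data.Nat using (ℕ; zero; suc; pred; _+_; _*_; _≤_; _≟_; NonZero; NonTrivial)
open import Data.Product using (Σ; ∃; _×_; _,_; proj₁; proj₂)
open import Data.Rational using (ℚ; 0ℚ; _/_) renaming (_<_ to _<ℚ_; _-_ to _-ℚ_; ∣_∣ to ∣_∣ℚ)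
open import Data.Sum using (_⊎_; inj₁; inj₂)
open import Data.Vec using ([]; _∷_; here; there)
open import Data.Vec.Properties using (≡-dec)
open import Function using (_∘_)
open import Function.Definitions using (Injective)
open import Relation.Binary.Definitions using (DecidableEquality)
open import Relation.Binary.PropositionalEquality
  using (_≡_; refl; sym; trans; cong)
open import Relation.Nullary using (¬_; _×-dec_; _⊎-dec_)
open import Relation.Unary using (Decidable)

private
  variable
    k m n : ℕ

infix 4 _≟ˢ_
_≟ˢ_ : DecidableEquality (Subset n)
_≟ˢ_ = ≡-dec _≟ᵇ_

allSubsets : ∀ n → List (Subset n)
allSubsets zero    = [] ∷ []
allSubsets (suc n) = map (outside ∷_) (allSubsets n) ++ map (inside ∷_) (allSubsets n)

image : (Fin m → Fin n) → Subset m → Subset n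
image f []            = ⊥
image f (outside ∷ s) = image (f ∘ suc) s
image f (inside  ∷ s) = ⁅ f zero ⁆ ∪ image (f ∘ suc) s

∈-image⁻ : (f : Fin m → Fin n) (s : Subset m) {y : Fin n} →
           y ∈ image f s → ∃ λ x → x ∈ s × f x ≡ y
∈-image⁻ f []            y∈ = ⊥-elim (∉⊥ y∈)
∈-image⁻ f (outside ∷ s) y∈ with ∈-image⁻ (f ∘ suc) s y∈
... | x , x∈s , eq = suc x , there x∈s , eq
∈-image⁻ f (inside ∷ s) y∈ with x∈p∪q⁻ ⁅ f zero ⁆ (image (f ∘ suc) s) y∈
... | inj₁ y∈⁅⁆ = zero , here , sym (x∈⁅y⁆⇒x≡y _ y∈⁅⁆)
... | inj₂ y∈im with ∈-image⁻ (f ∘ suc) s y∈im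
...   | x , x∈s , eq = suc x , there x∈s , eq

∣⁅x⁆∪p∣≡1+∣p∣ : (x : Fin n) (p : Subset n) → x ∉ p → ∣ ⁅ x ⁆ ∪ p ∣ ≡ suc ∣ p ∣
∣⁅x⁆∪p∣≡1+∣p∣ zero    (inside  ∷ p) x∉p = ⊥-elim (x∉p here)
∣⁅x⁆∪p∣≡1+∣p∣ zero    (outside ∷ p) x∉p = cong (suc ∘ ∣_∣) (∪-identityˡ p)
∣⁅x⁆∪p∣≡1+∣p∣ (suc x) (inside  ∷ p) x∉p = cong suc (∣⁅x⁆∪p∣≡1+∣p∣ x p (x∉p ∘ there))
∣⁅x⁆∪p∣≡1+∣p∣ (suc x) (outside ∷ p) x∉p = ∣⁅x⁆∪p∣≡1+∣p∣ x p (x∉p ∘ there)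

∣image∣ : (f : Fin m → Fin n) → Injective _≡_ _≡_ f → (s : Subset m) → ∣ image f s ∣ ≡ ∣ s ∣
∣image∣ {n = n} f inj []    = ∣⊥∣≡0 n
∣image∣ f inj (outside ∷ s) = ∣image∣ (f ∘ suc) (suc-injective ∘ inj) s
∣image∣ f inj (inside  ∷ s) =
  trans (∣⁅x⁆∪p∣≡1+∣p∣ (f zero) (image (f ∘ suc) s) f0∉)
        (cong suc (∣image∣ (f ∘ suc) (suc-injective ∘ inj) s))
  where
  f0∉ : f zero ∉ image (f ∘ suc) s
  f0∉ f0∈ with ∈-image⁻ (f ∘ suc) s f0∈
  ... | x , _ , eq with inj eq
  ...   | ()

-- A k-graph with vertex set Fin n.
record KGraph (k n : ℕ) : Set₁ where
  field
    Edge    : Subset n → Set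
    edge?   : Decidable Edge
    uniform : ∀ {e} → Edge e → ∣ e ∣ ≡ k

  edges : List (Subset n)
  edges = filter edge? (allSubsets n)

  codegree : Subset n → ℕ
  codegree S = length (filter (S ⊆?_) edges)

  shadow : List (Subset n)
  shadow = filter (λ S → (∣ S ∣ ≟ pred k) ×-dec anyL? (S ⊆?_) edges) (allSubsets n)

open KGraph public

minimum : List ℕ → ℕ
minimum []       = 0
minimum (x ∷ xs) = min x xs

-- For k ≥ 1 the shadow is empty exactly when there are no edges, and then δ⁺ H = 0.
δ⁺ : KGraph k n → ℕ
δ⁺ H = minimum (map (codegree H) (shadow H))

_IsCopyOf_In_ : (Fin m → Fin n) → KGraph k m → KGraph k n → Set
f IsCopyOf F In H = Injective _≡_ _≡_ f × (∀ {e} → Edge F e → Edge H (image f e))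

_Free_ : KGraph k m → KGraph k n → Set
F Free H = ¬ ∃ λ f → f IsCopyOf F In H

-- m = ex⁺(n,F)
IsEx⁺ : ∀ {v} → KGraph k v → (n m : ℕ) → Set₁
IsEx⁺ {k} F n m =
  (Σ (KGraph k n) λ H → F Free H × δ⁺ H ≡ m) ×
  (∀ (H : KGraph k n) → F Free H → δ⁺ H ≤ m)

infix 4 _⟶_
_⟶_ : (ℕ → ℚ) → ℚ → Set
a ⟶ L = ∀ ε → 0ℚ <ℚ ε → ∃ λ N → ∀ n → N ≤ n → ∣ a n -ℚ L ∣ℚ <ℚ ε

-- γ⁺(F) = L. The sequence ex⁺(n,F)/n is indexed from n = 1.
γ⁺_Is_ : KGraph k m → ℚ → Set₁
γ⁺ F Is L = Σ (ℕ → ℕ) λ ex →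
  (∀ n → IsEx⁺ F n (ex n)) × (λ n → + ex (suc n) / suc n) ⟶ L

Monochromatic : ∀ {r} → (Fin n → Fin r) → Subset n → Set
Monochromatic c e = ∀ {x y} → x ∈ e → y ∈ e → c x ≡ c y

Colourable : ℕ → KGraph k n → Set
Colourable {n = n} r H =
  ∃ λ (c : Fin n → Fin r) → ∀ {e} → Edge H e → ¬ Monochromatic c e

singleEdge : ∀ k → KGraph k k
singleEdge k = record
  { Edge    = _≡ ⊤
  ; edge?   = _≟ˢ ⊤
  ; uniform = λ { refl → ∣⊤∣≡n k }
  }

K : ∀ n → KGraph 2 n
K n = record
  { Edge    = λ e → ∣ e ∣ ≡ 2
  ; edge?   = λ e → ∣ e ∣ ≟ 2
  ; uniform = λ eq → eq
  }

-- F(R,H): the vertices are those of the core R followed by one block of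
-- vertices of H for each edge of R.
module Construction {a b} (R : KGraph k a) (H : KGraph (suc k) b) where

  size : ℕ
  size = length (edges R)

  S : Fin size → Subset a
  S = lookup (edges R)

  core : Fin a → Fin (a + size * b)
  core x = x ↑ˡ (size * b)

  copy : Fin size → Fin b → Fin (a + size * b)
  copy j x = a ↑ʳ combine j x

  FEdge : Subset (a + size * b) → Set
  FEdge e = ∃ λ j →
    (∃ λ x → e ≡ ⁅ copy j x ⁆ ∪ image core (S j)) ⊎
    (∃ λ h → Edge H h × e ≡ image (copy j) h)

  core-inj : Injective _≡_ _≡_ core
  core-inj = ↑ˡ-injective _ _ _

  copy-inj : ∀ j → Injective _≡_ _≡_ (copy j)
  copy-inj j eq = combine-injectiveʳ j _ j _ (↑ʳ-injective a _ _ eq)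

  core≢copy : ∀ x j y → ¬ core x ≡ copy j y
  core≢copy x j y eq
    with trans (sym (splitAt-↑ˡ a x (size * b)))
               (trans (cong (splitAt a) eq) (splitAt-↑ʳ a (size * b) (combine j y)))
  ... | ()

  ∣S∣ : ∀ j → ∣ S j ∣ ≡ k
  ∣S∣ j = uniform R (proj₂ (∈-filter⁻ (edge? R) {xs = allSubsets a} (∈-lookup j)))

  copy∉core : ∀ j x → copy j x ∉ image core (S j)
  copy∉core j x x∈ with ∈-image⁻ core (S j) x∈
  ... | y , _ , eq = core≢copy y j x eq

  FEdge-uniform : ∀ {e} → FEdge e → ∣ e ∣ ≡ suc k
  FEdge-uniform (j , inj₁ (x , refl)) =
    trans (∣⁅x⁆∪p∣≡1+∣p∣ (copy j x) (image core (S j)) (copy∉core j x))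
          (cong suc (trans (∣image∣ core core-inj (S j)) (∣S∣ j)))
  FEdge-uniform (j , inj₂ (h , h∈H , refl)) =
    trans (∣image∣ (copy j) (copy-inj j) h) (uniform H h∈H)

  F : KGraph (suc k) (a + size * b)
  F = record
    { Edge    = FEdge
    ; edge?   = λ e → any? λ j →
        any? (λ x → e ≟ˢ (⁅ copy j x ⁆ ∪ image core (S j))) ⊎-dec
        anySubset? (λ h → edge? H h ×-dec (e ≟ˢ image (copy j) h))
    ; uniform = FEdge-uniform
    }

open Construction public using (F)

H[_,_] : ∀ r k .{{_ : NonZero r}} .{{_ : NonTrivial k}} → ∃ (KGraph k)
H[ 1           , k                 ] = k , singleEdge k
H[ suc (suc r) , 2                 ] = suc (suc (suc r)) , K (suc (suc (suc r)))
H[ suc (suc r) , suc (suc (suc k)) ] =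
  _ , F (proj₂ H[ suc (suc r) , suc (suc k) ]) (proj₂ H[ suc r , suc (suc (suc k)) ])

{-# OPTIONS --safe #-}
module Submission where

-- Upper bound.  Call the deficiency of a k-graph G the largest number of vertices x for which S ∪ {x}
-- is not an edge, over all (k-1)-sets S contained in some edge.  If the deficiency is at most d, then
-- every vertex set A with |A| > r d + C contains a copy of H_r^k, by induction on r and k: the shadow
-- of G again has deficiency at most d, so A contains a copy of the core H_r^{k-1} in the shadow, and
-- for each core edge S the neighbours of S in A that are still unused number more than (r-1) d + C',
-- so they contain a copy of H_{r-1}^k.  Taking d = n - δ⁺(G) gives r δ⁺(G) ≤ (r-1) n + C for H_r^k-free G.
-- Lower bound.  A graph that is not r-colourable is not contained in the k-graph of all
-- non-monochromatic k-sets for a balanced r-colouring, whose δ⁺ is at least n - n/r - O(1).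

open import Defs
open import Data.Fin
  using (Fin; zero; suc; toℕ; fromℕ<; inject≤; splitAt; remQuot; combine; punchOut; finToFun; funToFin; _↑ʳ_)
  renaming (_≟_ to _≟ᶠ_)
open import Data.Fin.Properties
  using (all?; any?; splitAt-↑ˡ; splitAt-↑ʳ; join-splitAt; remQuot-combine; combine-remQuot; injective⇒≤;
         inject≤-injective; pigeonhole; punchOut-injective; finToFun-funToFin)
  renaming (suc-injective to sucᶠ-injective)
open import Data.Fin.Subset
  using (Subset; Nonempty; inside; outside; ⊥; ⊤; ⁅_⁆; _∈_; _∉_; _⊆_; _∪_; _∩_; ∁; ∣_∣)
open import Data.Fin.Subset.Properties
open import Data.Integer as ℤ using (ℤ; +_; +[1+_]; -[1+_]; _⊖_)
import Data.Integer.Properties as ℤ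
open import Data.List using (List; []; _∷_; map; filter; length; lookup)
open import Data.List.Extrema.Nat using (min≤⊤; min≤xs; v≤min⁺)
open import Data.List.Membership.Propositional using (lose; find) renaming (_∈_ to _∈ᴸ_)
open import Data.List.Membership.Propositional.Properties
  using (∈-lookup; ∈-filter⁺; ∈-filter⁻; ∈-++⁺ˡ; ∈-++⁺ʳ; ∈-map⁺; ∈-map⁻)
open import Data.List.Properties using (filter-≐)
open import Data.List.Relation.Unary.All as All using ()
open import Data.List.Relation.Unary.AllPairs using ([]; _∷_)
open import Data.List.Relation.Unary.Any using (Any; here; there; index) renaming (any? to anyL?)
open import Data.List.Relation.Unary.Any.Properties using (lookup-index)
open import Data.List.Relation.Unary.Unique.Propositional using (Unique)
import Data.List.Relation.Unary.Unique.Propositional.Properties as Unique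
open import Data.Nat
  using (ℕ; zero; suc; pred; _+_; _*_; _∸_; _≤_; _<_; z≤n; s≤s; _≟_; _<?_; _≤?_; NonZero; NonTrivial)
open import Data.Nat.DivMod using (_%_; m≡m%n+[m/n]*n; m%n<n) renaming (_/_ to _/ℕ_)
open import Data.Nat.Properties
open import Data.Nat.Solver using (module +-*-Solver)
open import Data.Product using (Σ; ∃; ∃₂; _×_; _,_; proj₁; proj₂; uncurry)
open import Data.Rational as ℚ using (ℚ; mkℚ; 0ℚ; toℚᵘ; _/_)
import Data.Rational.Properties as ℚ
open import Data.Rational.Unnormalised as ℚᵘ using (mkℚᵘ)
import Data.Rational.Unnormalised.Properties as ℚᵘ
open import Data.Sum using (_⊎_; inj₁; inj₂; [_,_]′)
open import Data.Vec using ([]; _∷_; here; there; tabulate)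
open import Data.Vec.Properties using (lookup∘tabulate; lookup⇒[]=; []=⇒lookup; ∷-injectiveʳ)
open import Function using (_∘_; id)
open import Function.Definitions using (Injective)
open import Relation.Binary.PropositionalEquality
  using (_≡_; _≢_; refl; sym; trans; cong; cong₂; subst; subst₂; _≗_)
open import Relation.Nullary using (¬_; ¬?; Dec; yes; no; does; contradiction; _×-dec_)
open import Relation.Nullary.Decidable using (dec-true; map′; decidable-stable; _→-dec_)
open import Relation.Unary using (Decidable)

private
  variable
    k l m n : ℕ

-- Finite sets

⟦_⟧ : {P : Fin n → Set} → Decidable P → Subset n
⟦ P? ⟧ = tabulate (does ∘ P?)

module _ {P : Fin n → Set} (P? : Decidable P) where

  ∈⟦⟧⁺ : ∀ {x} → P x → x ∈ ⟦ P? ⟧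
  ∈⟦⟧⁺ {x} px = lookup⇒[]= x _ (trans (lookup∘tabulate _ x) (dec-true (P? x) px))

  ∈⟦⟧⁻ : ∀ {x} → x ∈ ⟦ P? ⟧ → P x
  ∈⟦⟧⁻ {x} x∈ with trans (sym (lookup∘tabulate (does ∘ P?) x)) ([]=⇒lookup x∈)
  ... | eq with P? x
  ...   | yes px = px
  ∈⟦⟧⁻ {x} x∈ | () | no _

∣p∪q∣≤∣p∣+∣q∣ : (p q : Subset n) → ∣ p ∪ q ∣ ≤ ∣ p ∣ + ∣ q ∣
∣p∪q∣≤∣p∣+∣q∣ []            []            = z≤n
∣p∪q∣≤∣p∣+∣q∣ (outside ∷ p) (outside ∷ q) = ∣p∪q∣≤∣p∣+∣q∣ p q
∣p∪q∣≤∣p∣+∣q∣ (outside ∷ p) (inside  ∷ q) =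
  ≤-trans (s≤s (∣p∪q∣≤∣p∣+∣q∣ p q)) (≤-reflexive (sym (+-suc ∣ p ∣ ∣ q ∣)))
∣p∪q∣≤∣p∣+∣q∣ (inside  ∷ p) (outside ∷ q) = s≤s (∣p∪q∣≤∣p∣+∣q∣ p q)
∣p∪q∣≤∣p∣+∣q∣ (inside  ∷ p) (inside  ∷ q) =
  s≤s (≤-trans (∣p∪q∣≤∣p∣+∣q∣ p q) (+-monoʳ-≤ ∣ p ∣ (n≤1+n ∣ q ∣)))

∣p∣≤∣p∩∁q∣+∣q∣ : (p q : Subset n) → ∣ p ∣ ≤ ∣ p ∩ ∁ q ∣ + ∣ q ∣
∣p∣≤∣p∩∁q∣+∣q∣ p q = ≤-trans (p⊆q⇒∣p∣≤∣q∣ p⊆) (∣p∪q∣≤∣p∣+∣q∣ (p ∩ ∁ q) q)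
  where
  p⊆ : p ⊆ (p ∩ ∁ q) ∪ q
  p⊆ {x} x∈p with x ∈? q
  ... | yes x∈q = x∈p∪q⁺ (inj₂ x∈q)
  ... | no  x∉q = x∈p∪q⁺ (inj₁ (x∈p∩q⁺ (x∈p , x∉p⇒x∈∁p x∉q)))

∣p∣<∣q∣⇒∃∈q∉p : {p q : Subset n} → ∣ p ∣ < ∣ q ∣ → ∃ λ x → x ∈ q × x ∉ p
∣p∣<∣q∣⇒∃∈q∉p {p = p} {q} lt with nonempty? (q ∩ ∁ p)
... | yes (x , x∈) with x∈p∩q⁻ q (∁ p) x∈
...   | x∈q , x∈∁p = x , x∈q , x∈∁p⇒x∉p x∈∁p
∣p∣<∣q∣⇒∃∈q∉p {p = p} {q} lt | no empty = contradiction lt (≤⇒≯ (p⊆q⇒∣p∣≤∣q∣ q⊆p))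
  where
  q⊆p : q ⊆ p
  q⊆p {x} x∈q with x ∈? p
  ... | yes x∈p = x∈p
  ... | no  x∉p = contradiction (x , x∈p∩q⁺ (x∈q , x∉p⇒x∈∁p x∉p)) empty

x∈⁅x⁆∪p : (x : Fin n) (p : Subset n) → x ∈ ⁅ x ⁆ ∪ p
x∈⁅x⁆∪p x p = x∈p∪q⁺ (inj₁ (x∈⁅x⁆ x))

x∈p⇒⁅x⁆∪p≡p : {x : Fin n} {p : Subset n} → x ∈ p → ⁅ x ⁆ ∪ p ≡ p
x∈p⇒⁅x⁆∪p≡p {x = x} {p} x∈p = ⊆-antisym
  (λ y∈ → [ (λ y∈x → subst (_∈ p) (sym (x∈⁅y⁆⇒x≡y x y∈x)) x∈p) , id ]′ (x∈p∪q⁻ ⁅ x ⁆ p y∈))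
  (x∈p∪q⁺ ∘ inj₂)

∣insert∣ : {x : Fin n} {p : Subset n} → x ∉ p → ∣ p ∣ ≡ k → ∣ ⁅ x ⁆ ∪ p ∣ ≡ suc k
∣insert∣ {x = x} {p} x∉p ∣p∣≡k = trans (∣⁅x⁆∪p∣≡1+∣p∣ x p x∉p) (cong suc ∣p∣≡k)

insert-comm : (x y : Fin n) (p : Subset n) → ⁅ x ⁆ ∪ (⁅ y ⁆ ∪ p) ≡ ⁅ y ⁆ ∪ (⁅ x ⁆ ∪ p)
insert-comm {n} x y p =
  trans (sym (∪-assoc ⁅ x ⁆ ⁅ y ⁆ p))
        (trans (cong (_∪ p) (∪-comm ⁅ x ⁆ ⁅ y ⁆)) (∪-assoc ⁅ y ⁆ ⁅ x ⁆ p))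

∈⇒insert : {x : Fin n} {p : Subset n} → x ∈ p → ∃ λ q → p ≡ ⁅ x ⁆ ∪ q × x ∉ q
∈⇒insert {x = x} {p} x∈p =
  p ∩ ∁ ⁅ x ⁆ , ⊆-antisym p⊆ ⊆p , λ x∈ → x∈∁p⇒x∉p (proj₂ (x∈p∩q⁻ p _ x∈)) (x∈⁅x⁆ x)
  where
  p⊆ : p ⊆ ⁅ x ⁆ ∪ (p ∩ ∁ ⁅ x ⁆)
  p⊆ {y} y∈p with y ∈? ⁅ x ⁆
  ... | yes y∈x = x∈p∪q⁺ (inj₁ y∈x)
  ... | no  y∉x = x∈p∪q⁺ (inj₂ (x∈p∩q⁺ (y∈p , x∉p⇒x∈∁p y∉x)))
  ⊆p : ⁅ x ⁆ ∪ (p ∩ ∁ ⁅ x ⁆) ⊆ p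
  ⊆p y∈ with x∈p∪q⁻ ⁅ x ⁆ _ y∈
  ... | inj₁ y∈x = subst (_∈ p) (sym (x∈⁅y⁆⇒x≡y x y∈x)) x∈p
  ... | inj₂ y∈p = proj₁ (x∈p∩q⁻ p _ y∈p)

∣p∣>0⇒Nonempty : {p : Subset n} → 0 < ∣ p ∣ → Nonempty p
∣p∣>0⇒Nonempty {n = n} {p} 0<p with ∣p∣<∣q∣⇒∃∈q∉p {p = ⊥} {p} (subst (_< ∣ p ∣) (sym (∣⊥∣≡0 n)) 0<p)
... | x , x∈p , _ = x , x∈p

enumerate : (p : Subset n) → ∃ λ (f : Fin ∣ p ∣ → Fin n) →
            Injective _≡_ _≡_ f × (∀ i → f i ∈ p) × (∀ {x} → x ∈ p → ∃ λ i → f i ≡ x)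
enumerate [] = (λ ()) , (λ { {()} }) , (λ ()) , λ ()
enumerate (outside ∷ p) with enumerate p
... | f , inj , f∈ , sur = suc ∘ f , inj ∘ sucᶠ-injective , there ∘ f∈ ,
  λ { (there x∈) → let i , eq = sur x∈ in i , cong suc eq }
enumerate (inside ∷ p) with enumerate p
... | f , inj , f∈ , sur = g , g-inj , g∈ , g-sur
  where
  g : Fin (suc ∣ p ∣) → Fin _
  g zero    = zero
  g (suc i) = suc (f i)
  g-inj : Injective _≡_ _≡_ g
  g-inj {zero}  {zero}  _  = refl
  g-inj {suc i} {suc j} eq = cong suc (inj (sucᶠ-injective eq))
  g∈ : ∀ i → g i ∈ inside ∷ p
  g∈ zero    = here
  g∈ (suc i) = there (f∈ i)
  g-sur : ∀ {x} → x ∈ inside ∷ p → ∃ λ i → g i ≡ x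
  g-sur here       = zero , refl
  g-sur (there x∈) = let i , eq = sur x∈ in suc i , cong suc eq

-- Counting by an injection whose value may depend on the membership proof, as when an element is
-- sent to a list position that exists only for members.
∣p∣≤ : (p : Subset n) (g : ∀ {x} → x ∈ p → Fin m) →
       (∀ {x y} (x∈ : x ∈ p) (y∈ : y ∈ p) → g x∈ ≡ g y∈ → x ≡ y) → ∣ p ∣ ≤ m
∣p∣≤ p g g-inj with enumerate p
... | f , inj , f∈ , _ = injective⇒≤ {f = λ i → g (f∈ i)} (λ eq → inj (g-inj (f∈ _) (f∈ _) eq))

∈-image⁺ : (f : Fin m → Fin n) {s : Subset m} {x : Fin m} → x ∈ s → f x ∈ image f s
∈-image⁺ f {inside  ∷ s} here       = x∈⁅x⁆∪p (f zero) _
∈-image⁺ f {outside ∷ s} (there x∈) = ∈-image⁺ (f ∘ suc) x∈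
∈-image⁺ f {inside  ∷ s} (there x∈) = x∈p∪q⁺ (inj₂ (∈-image⁺ (f ∘ suc) x∈))

image-∘ : (f : Fin m → Fin n) (g : Fin l → Fin m) (s : Subset l) →
          image f (image g s) ≡ image (f ∘ g) s
image-∘ f g s = ⊆-antisym to from
  where
  to : image f (image g s) ⊆ image (f ∘ g) s
  to z∈ with ∈-image⁻ f _ z∈
  ... | y , y∈ , refl with ∈-image⁻ g s y∈
  ...   | x , x∈ , refl = ∈-image⁺ (f ∘ g) x∈
  from : image (f ∘ g) s ⊆ image f (image g s)
  from z∈ with ∈-image⁻ (f ∘ g) s z∈
  ... | x , x∈ , refl = ∈-image⁺ f (∈-image⁺ g x∈)

image-insert : (f : Fin m → Fin n) (x : Fin m) (s : Subset m) →
               image f (⁅ x ⁆ ∪ s) ≡ ⁅ f x ⁆ ∪ image f s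
image-insert f x s = ⊆-antisym to from
  where
  to : image f (⁅ x ⁆ ∪ s) ⊆ ⁅ f x ⁆ ∪ image f s
  to y∈ with ∈-image⁻ f _ y∈
  ... | z , z∈ , refl with x∈p∪q⁻ ⁅ x ⁆ s z∈
  ...   | inj₁ z∈x = x∈p∪q⁺ (inj₁ (subst (λ w → f w ∈ ⁅ f x ⁆) (sym (x∈⁅y⁆⇒x≡y x z∈x)) (x∈⁅x⁆ (f x))))
  ...   | inj₂ z∈s = x∈p∪q⁺ (inj₂ (∈-image⁺ f z∈s))
  from : ⁅ f x ⁆ ∪ image f s ⊆ image f (⁅ x ⁆ ∪ s)
  from y∈ with x∈p∪q⁻ ⁅ f x ⁆ _ y∈
  ... | inj₁ y∈x = subst (_∈ image f (⁅ x ⁆ ∪ s)) (sym (x∈⁅y⁆⇒x≡y (f x) y∈x)) (∈-image⁺ f (x∈⁅x⁆∪p x s))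
  ... | inj₂ y∈s with ∈-image⁻ f s y∈s
  ...   | z , z∈ , refl = ∈-image⁺ f {⁅ x ⁆ ∪ s} (x∈p∪q⁺ (inj₂ z∈))

image-cong : {f g : Fin m → Fin n} → f ≗ g → (s : Subset m) → image f s ≡ image g s
image-cong f≗g []            = refl
image-cong f≗g (outside ∷ s) = image-cong (f≗g ∘ suc) s
image-cong f≗g (inside  ∷ s) = cong₂ (λ x p → ⁅ x ⁆ ∪ p) (f≗g zero) (image-cong (f≗g ∘ suc) s)

∣image-⊤∣ : (f : Fin m → Fin n) → Injective _≡_ _≡_ f → ∣ image f ⊤ ∣ ≡ m
∣image-⊤∣ {m} f inj = trans (∣image∣ f inj ⊤) (∣⊤∣≡n m)

-- Forced copies

nbhd : KGraph k n → Subset n → Subset n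
nbhd G S = ⟦ (λ x → edge? G (⁅ x ⁆ ∪ S)) ⟧

-- The witness `u` restricts `S` to the shadow. The vertices of `S` count as missing too, since
-- inserting one of them gives no edge; thus `n ∸ δ⁺ G` is an admissible `d`.
Deficiency≤ : KGraph (suc k) n → ℕ → Set
Deficiency≤ {k} G d = ∀ {S u} → ∣ S ∣ ≡ k → Edge G (⁅ u ⁆ ∪ S) → ∣ ∁ (nbhd G S) ∣ ≤ d

insert-edge⇒∉ : (G : KGraph (suc k) n) {x : Fin n} {S : Subset n} →
                ∣ S ∣ ≡ k → Edge G (⁅ x ⁆ ∪ S) → x ∉ S
insert-edge⇒∉ G {S = S} ∣S∣≡k e x∈S =
  1+n≢n (trans (sym (uniform G e)) (trans (cong ∣_∣ (x∈p⇒⁅x⁆∪p≡p x∈S)) ∣S∣≡k))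

edge⇒insert : (G : KGraph (suc k) n) {e : Subset n} {x : Fin n} → Edge G e → x ∈ e →
              ∃ λ S → e ≡ ⁅ x ⁆ ∪ S × x ∉ S × ∣ S ∣ ≡ k
edge⇒insert G {e} {x} e∈G x∈e with ∈⇒insert x∈e
... | S , refl , x∉S = S , refl , x∉S , suc-injective (trans (sym (∣⁅x⁆∪p∣≡1+∣p∣ x S x∉S)) (uniform G e∈G))

edge-nonempty : (G : KGraph (suc k) n) {e : Subset n} → Edge G e → Nonempty e
edge-nonempty G e∈G = ∣p∣>0⇒Nonempty (subst (0 <_) (sym (uniform G e∈G)) (s≤s z≤n))

module _ (G : KGraph (suc k) n) {d : ℕ} (def : Deficiency≤ G d) {A : Subset n} (d<∣A∣ : d < ∣ A ∣) where

  neighbour-inside : ∀ {S u} → ∣ S ∣ ≡ k → Edge G (⁅ u ⁆ ∪ S) → ∃ λ x → x ∈ A × Edge G (⁅ x ⁆ ∪ S)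
  neighbour-inside {S} ∣S∣≡k e with ∣p∣<∣q∣⇒∃∈q∉p (≤-<-trans (def ∣S∣≡k e) d<∣A∣)
  ... | x , x∈A , x∉∁N = x , x∈A , ∈⟦⟧⁻ (λ y → edge? G (⁅ y ⁆ ∪ S)) (x∉∁p⇒x∈p x∉∁N)

  -- The vertices of an edge that lie outside A are exchanged one by one for vertices of A.
  edge-inside : ∃ (Edge G) → ∃ λ e → Edge G e × e ⊆ A
  edge-inside (e₀ , e₀∈G) = go n e₀ e₀∈G (∣p∣≤n (e₀ ∩ ∁ A))
    where
    go : ∀ fuel e → Edge G e → ∣ e ∩ ∁ A ∣ ≤ fuel → ∃ λ e → Edge G e × e ⊆ A
    go fuel e e∈G bound with nonempty? (e ∩ ∁ A)
    ... | no empty = e , e∈G , e⊆A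
      where
      e⊆A : e ⊆ A
      e⊆A {x} x∈e with x ∈? A
      ... | yes x∈A = x∈A
      ... | no  x∉A = contradiction (x , x∈p∩q⁺ (x∈e , x∉p⇒x∈∁p x∉A)) empty
    ... | yes (u , u∈) with x∈p∩q⁻ e (∁ A) u∈
    ... | u∈e , u∈∁A with edge⇒insert G e∈G u∈e
    ... | S , refl , u∉S , ∣S∣≡k with neighbour-inside ∣S∣≡k e∈G
    ... | x , x∈A , e′∈G = descend fuel bound
      where
      smaller : ∣ (⁅ x ⁆ ∪ S) ∩ ∁ A ∣ < ∣ (⁅ u ⁆ ∪ S) ∩ ∁ A ∣
      smaller = p⊂q⇒∣p∣<∣q∣ (sub , u , u∈ , u∉)
        where
        S-part : ∀ {y} → y ∈ (⁅ x ⁆ ∪ S) ∩ ∁ A → y ∈ S × y ∈ ∁ A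
        S-part y∈ with x∈p∩q⁻ (⁅ x ⁆ ∪ S) (∁ A) y∈
        ... | y∈e′ , y∈∁A with x∈p∪q⁻ ⁅ x ⁆ S y∈e′
        ...   | inj₂ y∈S = y∈S , y∈∁A
        ...   | inj₁ y∈x = contradiction (subst (_∈ A) (sym (x∈⁅y⁆⇒x≡y x y∈x)) x∈A) (x∈∁p⇒x∉p y∈∁A)
        sub : (⁅ x ⁆ ∪ S) ∩ ∁ A ⊆ (⁅ u ⁆ ∪ S) ∩ ∁ A
        sub y∈ = let y∈S , y∈∁A = S-part y∈ in x∈p∩q⁺ (x∈p∪q⁺ (inj₂ y∈S) , y∈∁A)
        u∉ : u ∉ (⁅ x ⁆ ∪ S) ∩ ∁ A
        u∉ u∈′ = u∉S (proj₁ (S-part u∈′))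
      descend : ∀ fuel → ∣ (⁅ u ⁆ ∪ S) ∩ ∁ A ∣ ≤ fuel → ∃ λ e → Edge G e × e ⊆ A
      descend zero       b = contradiction (<-≤-trans smaller b) λ ()
      descend (suc fuel) b = go fuel (⁅ x ⁆ ∪ S) e′∈G (≤-pred (<-≤-trans smaller b))

_EmbedsIn_Within_ : KGraph k m → KGraph k n → Subset n → Set
F EmbedsIn G Within A = ∃ λ f → f IsCopyOf F In G × (∀ x → f x ∈ A)

-- `C` is fixed before `n`, `G` and `d`, so that only the factor `r` matters in the limit. `A` is
-- arbitrary because the induction looks for copies in what is left of a neighbourhood.
Forced : KGraph (suc k) m → ℕ → ℕ → Set₁
Forced {k} F r C = ∀ {n} (G : KGraph (suc k) n) {d} → Deficiency≤ G d → ∃ (Edge G) →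
                   ∀ A → r * d + C < ∣ A ∣ → F EmbedsIn G Within A

singleEdge-forced : ∀ k → Forced (singleEdge (suc k)) 1 0
singleEdge-forced k G {d} def ne A lt
  with edge-inside G def {A} (subst (_< ∣ A ∣) (trans (+-identityʳ _) (+-identityʳ d)) lt) ne
... | e , e∈G , e⊆A with enumerate e | uniform G e∈G
-- Rewriting by the size of `e` turns its enumeration into a map on the vertex set of the single
-- edge.
... | f , inj , f∈ , sur | ∣e∣≡k rewrite ∣e∣≡k =
  f , (inj , λ { refl → subst (Edge G) (sym imf≡e) e∈G }) , e⊆A ∘ f∈
  where
  imf≡e : image f ⊤ ≡ e
  imf≡e = ⊆-antisym
    (λ y∈ → let i , _ , eq = ∈-image⁻ f ⊤ y∈ in subst (_∈ e) eq (f∈ i))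
    (λ y∈ → let i , eq = sur y∈ in subst (_∈ image f ⊤) eq (∈-image⁺ f ∈⊤))

∣p∣≡1⇒singleton : {p : Subset n} → ∣ p ∣ ≡ 1 → ∃ λ x → p ≡ ⁅ x ⁆
∣p∣≡1⇒singleton {n} {p} ∣p∣≡1 with ∣p∣>0⇒Nonempty {p = p} (≤-reflexive (sym ∣p∣≡1))
... | x , x∈p with ∈⇒insert x∈p
... | q , refl , x∉q = x , trans (cong (⁅ x ⁆ ∪_) (Empty-unique q-empty)) (∪-identityʳ ⁅ x ⁆)
  where
  q-empty : ¬ Nonempty q
  q-empty (y , y∈q) = n≮0 (subst (0 <_) (suc-injective (trans (sym (∣⁅x⁆∪p∣≡1+∣p∣ x q x∉q)) ∣p∣≡1))
      (≤-trans (≤-reflexive (sym (∣⁅x⁆∣≡1 y)))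
        (p⊆q⇒∣p∣≤∣q∣ λ z∈ → subst (_∈ q) (sym (x∈⁅y⁆⇒x≡y y z∈)) y∈q)))

-- Greedy clique building: a vertex `v` of `A` is joined to a clique found among its neighbours in
-- `A`.
K-forced : ∀ t → Forced (K (suc t)) t 0
K-forced zero G def ne A lt with ∣p∣>0⇒Nonempty lt
... | v , v∈A = (λ _ → v) , (inj , λ {e} → no-edge {e}) , λ _ → v∈A
  where
  inj : Injective {A = Fin 1} _≡_ _≡_ (λ _ → v)
  inj {zero} {zero} _ = refl
  no-edge : {e : Subset 1} → ∣ e ∣ ≡ 2 → Edge G (image (λ _ → v) e)
  no-edge {e} ∣e∣≡2 = contradiction (∣p∣≤n e) (<⇒≱ (≤-reflexive (sym ∣e∣≡2)))
K-forced (suc t) {n} G {d} def ne A lt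
  -- The edge inside `A` provides a `v` in `A` of positive degree; the deficiency says nothing about
  -- isolated vertices.
  with edge-inside G def {A} (≤-<-trans (≤-trans (m≤m+n d (t * d)) (m≤m+n (d + t * d) 0)) lt) ne
... | e , e∈G , e⊆A with edge-nonempty G e∈G
... | v , v∈e with edge⇒insert G e∈G v∈e
... | S , refl , v∉S , ∣S∣≡1 with ∣p∣≡1⇒singleton {p = S} ∣S∣≡1
... | u , refl = extend (K-forced t G def ne A′ ∣A′∣>)
  where
  -- The neighbours of `v` in `A`, written as `A` minus the non-neighbours to match the counting
  -- lemma.
  A′ = A ∩ ∁ (∁ (nbhd G ⁅ v ⁆))
  uv∈G : Edge G (⁅ u ⁆ ∪ ⁅ v ⁆)
  uv∈G = subst (Edge G) (∪-comm ⁅ v ⁆ ⁅ u ⁆) e∈G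
  ∣A′∣> : t * d + 0 < ∣ A′ ∣
  ∣A′∣> = +-cancelʳ-< d _ _ (begin-strict
    t * d + 0 + d     ≡⟨ trans (+-comm (t * d + 0) d) (sym (+-assoc d (t * d) 0)) ⟩
    d + t * d + 0     <⟨ lt ⟩
    ∣ A ∣              ≤⟨ ∣p∣≤∣p∩∁q∣+∣q∣ A (∁ (nbhd G ⁅ v ⁆)) ⟩
    ∣ A′ ∣ + _         ≤⟨ +-monoʳ-≤ ∣ A′ ∣ (def (∣⁅x⁆∣≡1 v) uv∈G) ⟩
    ∣ A′ ∣ + d         ∎)
    where open ≤-Reasoning
  extend : K (suc t) EmbedsIn G Within A′ → K (suc (suc t)) EmbedsIn G Within A
  extend (g , (g-inj , g-edge) , g∈) = f , (f-inj , (λ {e} → f-edge {e})) , f∈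
    where
    g-nbr : ∀ x → Edge G (⁅ g x ⁆ ∪ ⁅ v ⁆)
    g-nbr x = ∈⟦⟧⁻ (λ y → edge? G (⁅ y ⁆ ∪ ⁅ v ⁆)) (x∉∁p⇒x∈p (x∈∁p⇒x∉p (proj₂ (x∈p∩q⁻ A _ (g∈ x)))))
    g≢v : ∀ x → g x ≢ v
    g≢v x eq = insert-edge⇒∉ G (∣⁅x⁆∣≡1 v) (g-nbr x) (subst (_∈ ⁅ v ⁆) (sym eq) (x∈⁅x⁆ v))
    f : Fin (suc (suc t)) → Fin n
    f zero    = v
    f (suc x) = g x
    f-inj : Injective _≡_ _≡_ f
    f-inj {zero}  {zero}  _  = refl
    f-inj {zero}  {suc y} eq = contradiction (sym eq) (g≢v y)
    f-inj {suc x} {zero}  eq = contradiction eq (g≢v x)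
    f-inj {suc x} {suc y} eq = cong suc (g-inj eq)
    f∈ : ∀ x → f x ∈ A
    f∈ zero    = e⊆A v∈e
    f∈ (suc x) = proj₁ (x∈p∩q⁻ A _ (g∈ x))
    f-edge : ∀ {e} → ∣ e ∣ ≡ 2 → Edge G (image f e)
    f-edge {outside ∷ e} ∣e∣≡2 = g-edge {e} ∣e∣≡2
    f-edge {inside  ∷ e} ∣e∣≡2 with ∣p∣≡1⇒singleton {p = e} (cong pred ∣e∣≡2)
    ... | x , refl = subst (Edge G) eq (g-nbr x)
      where
      image-⁅⁆ : image g ⁅ x ⁆ ≡ ⁅ g x ⁆
      image-⁅⁆ = ⊆-antisym
        (λ y∈ → let z , z∈ , eq = ∈-image⁻ g ⁅ x ⁆ y∈ in
                subst (_∈ ⁅ g x ⁆) (trans (cong g (sym (x∈⁅y⁆⇒x≡y x z∈))) eq) (x∈⁅x⁆ (g x)))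
        (λ y∈ → subst (_∈ image g ⁅ x ⁆) (sym (x∈⁅y⁆⇒x≡y (g x) y∈)) (∈-image⁺ g (x∈⁅x⁆ x)))
      eq : ⁅ g x ⁆ ∪ ⁅ v ⁆ ≡ ⁅ v ⁆ ∪ image g ⁅ x ⁆
      eq = trans (∪-comm ⁅ g x ⁆ ⁅ v ⁆) (cong (⁅ v ⁆ ∪_) (sym image-⁅⁆))

-- Shadows and disjoint systems of maps

∂ : KGraph (suc k) n → KGraph k n
∂ {k} G = record
  { Edge    = λ S → ∣ S ∣ ≡ k × ∃ λ u → Edge G (⁅ u ⁆ ∪ S)
  ; edge?   = λ S → (∣ S ∣ ≟ k) ×-dec any? λ u → edge? G (⁅ u ⁆ ∪ S)
  ; uniform = proj₁
  }

∂-nonempty : (G : KGraph (suc k) n) → ∃ (Edge G) → ∃ (Edge (∂ G))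
∂-nonempty G (e , e∈G) with edge-nonempty G e∈G
... | u , u∈e with edge⇒insert G e∈G u∈e
...   | S , refl , _ , ∣S∣≡k = S , ∣S∣≡k , u , e∈G

-- If `u` completes `⁅ v ⁆ ∪ S` to an edge of `G`, then `⁅ u ⁆ ∪ S` lies in the shadow, and each of
-- its neighbours in `G` is a neighbour of `S` in `∂ G`, again with `u` as the witness.
∂-deficiency : (G : KGraph (suc (suc k)) n) {d : ℕ} → Deficiency≤ G d → Deficiency≤ (∂ G) d
∂-deficiency G {d} def {S} {v} ∣S∣≡k (∣vS∣ , u , e) = ≤-trans (p⊆q⇒∣p∣≤∣q∣ sub) (def ∣uS∣ vuS∈G)
  where
  uS = ⁅ u ⁆ ∪ S
  vuS∈G : Edge G (⁅ v ⁆ ∪ uS)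
  vuS∈G = subst (Edge G) (insert-comm u v S) e
  u∉S : u ∉ S
  u∉S u∈S = insert-edge⇒∉ G ∣vS∣ e (x∈p∪q⁺ (inj₂ u∈S))
  ∣uS∣ : ∣ uS ∣ ≡ _
  ∣uS∣ = ∣insert∣ u∉S ∣S∣≡k
  sub : ∁ (nbhd (∂ G) S) ⊆ ∁ (nbhd G uS)
  sub {x} x∉ = x∉p⇒x∈∁p λ x∈ → x∈∁p⇒x∉p x∉
    (∈⟦⟧⁺ (λ y → edge? (∂ G) (⁅ y ⁆ ∪ S)) (xS∈∂G (∈⟦⟧⁻ (λ y → edge? G (⁅ y ⁆ ∪ uS)) x∈)))
    where
    xS∈∂G : Edge G (⁅ x ⁆ ∪ uS) → Edge (∂ G) (⁅ x ⁆ ∪ S)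
    xS∈∂G xuS∈G =
      ∣insert∣ (λ x∈S → insert-edge⇒∉ G ∣uS∣ xuS∈G (x∈p∪q⁺ (inj₂ x∈S))) ∣S∣≡k
      , u , subst (Edge G) (insert-comm x u S) xuS∈G

-- Greedy choice: each map avoids `U` and the images of all earlier ones. These forbidden vertices
-- never exceed `B`, so `choose` applies at every stage.
disjointSystem : ∀ s {b B} (P : Fin s → (Fin b → Fin n) → Set) →
  (∀ j U → ∣ U ∣ ≤ B → ∃ λ h → P j h × Injective _≡_ _≡_ h × (∀ x → h x ∉ U)) →
  ∀ U → ∣ U ∣ + s * b ≤ B →
  ∃ λ (h : Fin s → Fin b → Fin n) → (∀ j → P j (h j)) × (∀ j x → h j x ∉ U) ×
    (∀ {i j x y} → h i x ≡ h j y → i ≡ j × x ≡ y)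
disjointSystem zero P choose U bound = (λ ()) , (λ ()) , (λ ()) , λ { {()} }
disjointSystem {n} (suc s) {b} {B} P choose U bound
  with choose zero U (≤-trans (m≤m+n ∣ U ∣ _) bound)
... | h₀ , P₀ , inj₀ , h₀∉
  with disjointSystem s (P ∘ suc) (choose ∘ suc) (U ∪ image h₀ ⊤) (begin
      ∣ U ∪ image h₀ ⊤ ∣ + s * b         ≤⟨ +-monoˡ-≤ (s * b) (∣p∪q∣≤∣p∣+∣q∣ U (image h₀ ⊤)) ⟩
      ∣ U ∣ + ∣ image h₀ ⊤ ∣ + s * b     ≡⟨ cong (λ t → ∣ U ∣ + t + s * b) (∣image-⊤∣ h₀ inj₀) ⟩
      ∣ U ∣ + b + s * b                  ≡⟨ +-assoc ∣ U ∣ b (s * b) ⟩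
      ∣ U ∣ + (b + s * b)                ≤⟨ bound ⟩
      B                                  ∎)
  where open ≤-Reasoning
... | h , Ph , h∉ , h-inj = g , Pg , g∉ , g-inj
  where
  g : Fin (suc s) → Fin b → Fin n
  g zero    = h₀
  g (suc j) = h j
  Pg : ∀ j → P j (g j)
  Pg zero    = P₀
  Pg (suc j) = Ph j
  g∉ : ∀ j x → g j x ∉ U
  g∉ zero    x = h₀∉ x
  g∉ (suc j) x = h∉ j x ∘ x∈p∪q⁺ ∘ inj₁
  h₀≢h : ∀ j x y → h₀ x ≢ h j y
  h₀≢h j x y eq = h∉ j y (x∈p∪q⁺ (inj₂ (subst (_∈ image h₀ ⊤) eq (∈-image⁺ h₀ ∈⊤))))
  g-inj : ∀ {i j x y} → g i x ≡ g j y → i ≡ j × x ≡ y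
  g-inj {zero}  {zero}  eq = refl , inj₀ eq
  g-inj {zero}  {suc j} eq = contradiction eq (h₀≢h j _ _)
  g-inj {suc i} {zero}  eq = contradiction (sym eq) (h₀≢h i _ _)
  g-inj {suc i} {suc j} eq = let p , q = h-inj eq in cong suc p , q

-- Copies of F(R,H)

module _ {a b} (R : KGraph k a) (H : KGraph (suc k) b) where

  open Construction R H hiding (F)

  S-edge : ∀ j → Edge R (S j)
  S-edge j = proj₂ (∈-filter⁻ (edge? R) {xs = allSubsets a} (∈-lookup j))

  core⊎copy : ∀ v → (∃ λ x → v ≡ core x) ⊎ (∃₂ λ j x → v ≡ copy j x)
  core⊎copy v with splitAt a v | join-splitAt a (size * b) v
  ... | inj₁ x | refl = inj₁ (x , refl)
  ... | inj₂ y | refl = inj₂ (_ , _ , cong (a ↑ʳ_) (sym (combine-remQuot {size} b y)))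

  glue : {A : Set} → (Fin a → A) → (Fin size → Fin b → A) → Fin (a + size * b) → A
  glue g h = [ g , uncurry h ∘ remQuot b ]′ ∘ splitAt a

  glue-core : ∀ {A : Set} (g : Fin a → A) h x → glue g h (core x) ≡ g x
  glue-core g h x rewrite splitAt-↑ˡ a x (size * b) = refl

  glue-copy : ∀ {A : Set} (g : Fin a → A) h j x → glue g h (copy j x) ≡ h j x
  glue-copy g h j x rewrite splitAt-↑ʳ a (size * b) (combine j x) = cong (uncurry h) (remQuot-combine j x)

  -- The three separation hypotheses make the glued map injective; `star` and `h-copy` take care of
  -- the two kinds of edge of `F R H`.
  glue-copyOf : (G : KGraph (suc k) n) (g : Fin a → Fin n) (h : Fin size → Fin b → Fin n) →
    Injective _≡_ _≡_ g → (∀ {i j x y} → h i x ≡ h j y → i ≡ j × x ≡ y) → (∀ i x y → g i ≢ h x y) →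
    (∀ j x → Edge G (⁅ h j x ⁆ ∪ image g (S j))) → (∀ j → h j IsCopyOf H In G) →
    glue g h IsCopyOf F R H In G
  glue-copyOf G g h g-inj h-inj g≢h star h-copy = inj , λ {e} → edge {e}
    where
    f = glue g h
    inj : Injective _≡_ _≡_ f
    inj {v} {w} eq with core⊎copy v | core⊎copy w
    ... | inj₁ (x , refl) | inj₁ (y , refl) =
      cong core (g-inj (trans (sym (glue-core g h x)) (trans eq (glue-core g h y))))
    ... | inj₁ (x , refl) | inj₂ (j , y , refl) =
      contradiction (trans (sym (glue-core g h x)) (trans eq (glue-copy g h j y))) (g≢h x j y)
    ... | inj₂ (i , x , refl) | inj₁ (y , refl) =
      contradiction (trans (sym (glue-core g h y)) (trans (sym eq) (glue-copy g h i x))) (g≢h y i x)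
    ... | inj₂ (i , x , refl) | inj₂ (j , y , refl)
      with h-inj (trans (sym (glue-copy g h i x)) (trans eq (glue-copy g h j y)))
    ...   | refl , refl = refl
    edge : ∀ {e} → Edge (F R H) e → Edge G (image f e)
    edge (j , inj₁ (x , refl)) = subst (Edge G)
      (sym (trans (image-insert f (copy j x) (image core (S j))) (cong₂ (λ y p → ⁅ y ⁆ ∪ p) (glue-copy g h j x)
        (trans (image-∘ f core (S j)) (image-cong (glue-core g h) (S j)))))) (star j x)
    edge (j , inj₂ (e , e∈H , refl)) = subst (Edge G)
      (sym (trans (image-∘ f (copy j) e) (image-cong (glue-copy g h j) e))) (proj₂ (h-copy j) e∈H)

F-forced : ∀ {a b r C C′} (R : KGraph (suc k) a) (H : KGraph (suc (suc k)) b) →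
           Forced R (suc r) C → Forced H r C′ → ∃ (Forced (F R H) (suc r))
-- `B` is the number of vertices of `F R H`, hence a bound on those in use at any time. Removing
-- them and at most `d` non-neighbours from `A` costs one multiple of `d` and the summand `B`, which
-- leaves more than `r * d + C′`.
F-forced {k} {a} {b} {r} {C} {C′} R H R-forced H-forced = C + (C′ + B) , forced
  where
  open Construction R H hiding (F)
  B = a + size * b
  forced : Forced (F R H) (suc r) (C + (C′ + B))
  forced {n} G {d} def ne A lt
    -- The core is placed in the shadow, so that the deficiency bound applies to the image of each
    -- core edge.
    with R-forced (∂ G) (∂-deficiency G def) (∂-nonempty G ne) A
           (≤-<-trans (+-monoʳ-≤ (suc r * d) (m≤m+n C _)) lt)
  -- At first only the image of the core is forbidden: `a` vertices, which with `size` blocks of `b`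
  -- make exactly `B`.
  ... | g , (g-inj , g-edge) , g∈ = finish (disjointSystem size P choose (image g ⊤)
          (≤-reflexive (cong (_+ size * b) (∣image-⊤∣ g g-inj))))
    where
    P : Fin size → (Fin b → Fin n) → Set
    P j h = (∀ x → h x ∈ A) × (∀ x → Edge G (⁅ h x ⁆ ∪ image g (S j))) × h IsCopyOf H In G
    choose : ∀ j U → ∣ U ∣ ≤ B → ∃ λ h → P j h × Injective _≡_ _≡_ h × (∀ x → h x ∉ U)
    choose j U ∣U∣≤B = unpack (H-forced G def ne A′ ∣A′∣>)
      where
      T = image g (S j)
      T∈∂G : Edge (∂ G) T
      T∈∂G = g-edge (S-edge R H j)
      X = ∁ (nbhd G T) ∪ U
      A′ = A ∩ ∁ X
      ∣X∣≤ : ∣ X ∣ ≤ d + B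
      ∣X∣≤ = ≤-trans (∣p∪q∣≤∣p∣+∣q∣ (∁ (nbhd G T)) U)
                    (+-mono-≤ (def (proj₁ T∈∂G) (proj₂ (proj₂ T∈∂G))) ∣U∣≤B)
      ∣A′∣> : r * d + C′ < ∣ A′ ∣
      ∣A′∣> = +-cancelʳ-< (d + B) _ _ (begin-strict
        r * d + C′ + (d + B)        ≡⟨ solve 4 (λ x c d b → x :+ c :+ (d :+ b) := d :+ x :+ (c :+ b))
                                         refl (r * d) C′ d B ⟩
        d + r * d + (C′ + B)        ≤⟨ +-monoʳ-≤ (d + r * d) (m≤n+m (C′ + B) C) ⟩
        d + r * d + (C + (C′ + B))  <⟨ lt ⟩
        ∣ A ∣                        ≤⟨ ∣p∣≤∣p∩∁q∣+∣q∣ A X ⟩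
        ∣ A′ ∣ + ∣ X ∣                ≤⟨ +-monoʳ-≤ ∣ A′ ∣ ∣X∣≤ ⟩
        ∣ A′ ∣ + (d + B)             ∎)
        where
        open ≤-Reasoning
        open +-*-Solver
      unpack : H EmbedsIn G Within A′ → ∃ λ h → P j h × Injective _≡_ _≡_ h × (∀ x → h x ∉ U)
      unpack (h , h-copy , h∈) = h , (h∈A , star , h-copy) , proj₁ h-copy , λ x → h∉X x ∘ x∈p∪q⁺ ∘ inj₂
        where
        h∈A : ∀ x → h x ∈ A
        h∈A x = proj₁ (x∈p∩q⁻ A _ (h∈ x))
        h∉X : ∀ x → h x ∉ X
        h∉X x = x∈∁p⇒x∉p (proj₂ (x∈p∩q⁻ A _ (h∈ x)))
        star : ∀ x → Edge G (⁅ h x ⁆ ∪ T)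
        star x = ∈⟦⟧⁻ (λ y → edge? G (⁅ y ⁆ ∪ T)) (x∉∁p⇒x∈p (h∉X x ∘ x∈p∪q⁺ ∘ inj₁))
    finish : (∃ λ (h : Fin size → Fin b → Fin n) → (∀ j → P j (h j)) × (∀ j x → h j x ∉ image g ⊤) ×
               (∀ {i j x y} → h i x ≡ h j y → i ≡ j × x ≡ y)) → F R H EmbedsIn G Within A
    finish (h , Ph , h∉ , h-inj) = glue R H g h ,
      glue-copyOf R H G g h g-inj h-inj
        (λ i j x eq → h∉ j x (subst (_∈ image g ⊤) eq (∈-image⁺ g ∈⊤)))
        (λ j → proj₁ (proj₂ (Ph j))) (λ j → proj₂ (proj₂ (Ph j))) ,
      inside-A
      where
      inside-A : ∀ v → glue R H g h v ∈ A
      inside-A v with core⊎copy R H v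
      ... | inj₁ (x , refl)     = subst (_∈ A) (sym (glue-core R H g h x)) (g∈ x)
      ... | inj₂ (j , x , refl) = subst (_∈ A) (sym (glue-copy R H g h j x)) (proj₁ (Ph j) x)

-- The parameters stand for `suc r` and `suc (suc k)`; as in `H[_,_]`, the recursion lowers `k` for
-- the core and `r` for the blocks.
H-forced : ∀ r k → ∃ (Forced (proj₂ H[ suc r , suc (suc k) ]) (suc r))
H-forced zero    k       = 0 , singleEdge-forced (suc k)
H-forced (suc r) zero    = 0 , K-forced (suc (suc r))
H-forced (suc r) (suc k) =
  F-forced {r = suc r} (proj₂ H[ suc (suc r) , suc (suc k) ]) (proj₂ H[ suc r , suc (suc (suc k)) ])
           (proj₂ (H-forced (suc r) k)) (proj₂ (H-forced r (suc k)))

-- The list of all subsets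

allSubsets-complete : (p : Subset n) → p ∈ᴸ allSubsets n
allSubsets-complete []            = here refl
allSubsets-complete (outside ∷ p) = ∈-++⁺ˡ (∈-map⁺ (outside ∷_) (allSubsets-complete p))
allSubsets-complete (inside  ∷ p) = ∈-++⁺ʳ (map (outside ∷_) (allSubsets _))
  (∈-map⁺ (inside ∷_) (allSubsets-complete p))

-- Ensures that `codegree`, the length of a filtered list, counts no edge twice.
allSubsets-unique : ∀ n → Unique (allSubsets n)
allSubsets-unique zero    = All.[] ∷ []
allSubsets-unique (suc n) = Unique.++⁺
  (Unique.map⁺ ∷-injectiveʳ (allSubsets-unique n)) (Unique.map⁺ ∷-injectiveʳ (allSubsets-unique n)) disjoint
  where
  disjoint : ∀ {p} → ¬ (p ∈ᴸ map (outside ∷_) (allSubsets n) × p ∈ᴸ map (inside ∷_) (allSubsets n))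
  disjoint (p∈ , p∈′) with ∈-map⁻ (outside ∷_) p∈ | ∈-map⁻ (inside ∷_) p∈′
  ... | _ , _ , refl | _ , _ , ()

unique⇒lookup-injective : {A : Set} {xs : List A} → Unique xs → Injective _≡_ _≡_ (lookup xs)
unique⇒lookup-injective (x∉xs ∷ u) {zero}  {zero}  _  = refl
unique⇒lookup-injective (x∉xs ∷ u) {zero}  {suc j} eq = contradiction eq (All.lookup x∉xs (∈-lookup j))
unique⇒lookup-injective (x∉xs ∷ u) {suc i} {zero}  eq = contradiction (sym eq) (All.lookup x∉xs (∈-lookup i))
unique⇒lookup-injective (x∉xs ∷ u) {suc i} {suc j} eq = cong suc (unique⇒lookup-injective u eq)

∈-edges⁺ : (G : KGraph k n) {e : Subset n} → Edge G e → e ∈ᴸ edges G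
∈-edges⁺ G e∈G = ∈-filter⁺ (edge? G) (allSubsets-complete _) e∈G

∈-edges⁻ : (G : KGraph k n) {e : Subset n} → e ∈ᴸ edges G → Edge G e
∈-edges⁻ {n = n} G e∈ = proj₂ (∈-filter⁻ (edge? G) {xs = allSubsets n} e∈)

-- Non-colourability

-- Two of the `suc r` vertices share a colour, and any two vertices form an edge.
K-notColourable : ∀ r → ¬ Colourable r (K (suc r))
K-notColourable r (c , proper) with pigeonhole (n<1+n r) c
... | i , j , i<j , ci≡cj = proper {⁅ i ⁆ ∪ ⁅ j ⁆} ∣ij∣≡2 λ x∈ y∈ → trans (colour x∈) (sym (colour y∈))
  where
  ∣ij∣≡2 : ∣ ⁅ i ⁆ ∪ ⁅ j ⁆ ∣ ≡ 2
  ∣ij∣≡2 = ∣insert∣ (λ i∈ → <⇒≢ i<j (cong toℕ (x∈⁅y⁆⇒x≡y j i∈))) (∣⁅x⁆∣≡1 j)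
  colour : ∀ {x} → x ∈ ⁅ i ⁆ ∪ ⁅ j ⁆ → c x ≡ c j
  colour x∈ with x∈p∪q⁻ ⁅ i ⁆ ⁅ j ⁆ x∈
  ... | inj₁ x∈i = trans (cong c (x∈⁅y⁆⇒x≡y i x∈i)) ci≡cj
  ... | inj₂ x∈j = cong c (x∈⁅y⁆⇒x≡y j x∈j)

-- In a proper colouring of F(R,H), no block over an edge of the core of colour i uses i.
F-notColourable : ∀ {a b r} (R : KGraph (suc k) a) (H : KGraph (suc (suc k)) b) →
                  ¬ Colourable (suc r) R → ¬ Colourable r H → ¬ Colourable (suc r) (F R H)
F-notColourable {k} {a} {b} {r} R H ¬R ¬H (c , proper) = ¬R (c ∘ core , λ {e} → core-proper {e})
  where
  open Construction R H hiding (F)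
  core-proper : ∀ {e} → Edge R e → ¬ Monochromatic (c ∘ core) e
  core-proper {e} e∈R mono with edge-nonempty R e∈R
  ... | x₀ , x₀∈e = ¬H (c′ , c′-proper)
    where
    i = c (core x₀)
    -- The block attached to the core edge `e`, found by the position of `e` in `edges R`.
    j = index (∈-edges⁺ R e∈R)
    e≡Sj : e ≡ S j
    e≡Sj = lookup-index (∈-edges⁺ R e∈R)
    -- A block vertex of colour `i` would form a monochromatic edge with `S j`.
    i≢ : ∀ x → i ≢ c (copy j x)
    i≢ x eq = proper (j , inj₁ (x , refl)) λ y∈ z∈ → trans (colour y∈) (sym (colour z∈))
      where
      colour : ∀ {y} → y ∈ ⁅ copy j x ⁆ ∪ image core (S j) → c y ≡ i
      colour y∈ with x∈p∪q⁻ ⁅ copy j x ⁆ _ y∈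
      ... | inj₁ y∈x = trans (cong c (x∈⁅y⁆⇒x≡y _ y∈x)) (sym eq)
      ... | inj₂ y∈S with ∈-image⁻ core (S j) y∈S
      ...   | z , z∈S , refl = mono (subst (z ∈_) (sym e≡Sj) z∈S) x₀∈e
    c′ : Fin b → Fin r
    c′ x = punchOut (i≢ x)
    c′-proper : ∀ {h} → Edge H h → ¬ Monochromatic c′ h
    c′-proper {h} h∈H mono′ = proper (j , inj₂ (h , h∈H , refl)) mono″
      where
      mono″ : Monochromatic c (image (copy j) h)
      mono″ y∈ z∈ with ∈-image⁻ (copy j) h y∈ | ∈-image⁻ (copy j) h z∈
      ... | y , y∈h , refl | z , z∈h , refl = punchOut-injective (i≢ y) (i≢ z) (mono′ y∈h z∈h)

H-notColourable : ∀ r k → ¬ Colourable (suc r) (proj₂ H[ suc r , suc (suc k) ])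
H-notColourable zero    k       (c , proper) = proper refl λ {x} {y} _ _ → fin1 (c x) (c y)
  where
  fin1 : (i j : Fin 1) → i ≡ j
  fin1 zero zero = refl
H-notColourable (suc r) zero    = K-notColourable (suc (suc r))
H-notColourable (suc r) (suc k) = F-notColourable (proj₂ H[ suc (suc r) , suc (suc k) ])
  (proj₂ H[ suc r , suc (suc (suc k)) ]) (H-notColourable (suc r) k) (H-notColourable r (suc k))

-- Minimum positive codegree

p⊆q∧∣q∣≤∣p∣⇒p≡q : {p q : Subset n} → p ⊆ q → ∣ q ∣ ≤ ∣ p ∣ → p ≡ q
p⊆q∧∣q∣≤∣p∣⇒p≡q {p = p} {q} p⊆q q≤p = ⊆-antisym p⊆q q⊆p
  where
  q⊆p : q ⊆ p
  q⊆p {x} x∈q with x ∈? p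
  ... | yes x∈p = x∈p
  ... | no  x∉p = contradiction q≤p (<⇒≱ (p⊂q⇒∣p∣<∣q∣ (p⊆q , x , x∈q , x∉p)))

-- The sizes leave room for only one vertex of `e` outside `S`. This translates codegrees, which
-- count edges containing `S`, into neighbourhoods.
superedge⇒insert : (G : KGraph (suc k) n) {S e : Subset n} → ∣ S ∣ ≡ k → Edge G e → S ⊆ e →
                   ∃ λ x → ⁅ x ⁆ ∪ S ≡ e
superedge⇒insert G {S} {e} ∣S∣≡k e∈G S⊆e
  with ∣p∣<∣q∣⇒∃∈q∉p {p = S} {e} (≤-reflexive (trans (cong suc ∣S∣≡k) (sym (uniform G e∈G))))
... | x , x∈e , x∉S = x , p⊆q∧∣q∣≤∣p∣⇒p≡q sub
    (≤-reflexive (trans (uniform G e∈G) (sym (∣insert∣ x∉S ∣S∣≡k))))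
  where
  sub : ⁅ x ⁆ ∪ S ⊆ e
  sub y∈ with x∈p∪q⁻ ⁅ x ⁆ S y∈
  ... | inj₁ y∈x = subst (_∈ e) (sym (x∈⁅y⁆⇒x≡y x y∈x)) x∈e
  ... | inj₂ y∈S = S⊆e y∈S

module _ (G : KGraph (suc k) n) where

  private
    -- Agrees definitionally with the test inside `shadow`, so that the membership lemmas for
    -- `filter` apply.
    inShadow? : Decidable (λ S → ∣ S ∣ ≡ k × Any (S ⊆_) (edges G))
    inShadow? S = (∣ S ∣ ≟ k) ×-dec anyL? (S ⊆?_) (edges G)

  ∈-shadow⁺ : ∀ {S u} → ∣ S ∣ ≡ k → Edge G (⁅ u ⁆ ∪ S) → S ∈ᴸ shadow G
  ∈-shadow⁺ ∣S∣≡k e = ∈-filter⁺ inShadow? (allSubsets-complete _)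
    (∣S∣≡k , lose (∈-edges⁺ G e) (x∈p∪q⁺ ∘ inj₂))

  ∈-shadow⁻ : ∀ {S} → S ∈ᴸ shadow G → ∣ S ∣ ≡ k × ∃ λ u → Edge G (⁅ u ⁆ ∪ S)
  ∈-shadow⁻ S∈ with ∈-filter⁻ inShadow? {xs = allSubsets n} S∈
  ... | _ , ∣S∣≡k , any with find any
  ...   | e , e∈ , S⊆e with superedge⇒insert G ∣S∣≡k (∈-edges⁻ G e∈) S⊆e
  ...     | u , eq = ∣S∣≡k , u , subst (Edge G) (sym eq) (∈-edges⁻ G e∈)

  module _ {S : Subset n} (∣S∣≡k : ∣ S ∣ ≡ k) where

    private
      N? : Decidable (λ x → Edge G (⁅ x ⁆ ∪ S))
      N? x = edge? G (⁅ x ⁆ ∪ S)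
      star : List (Subset n)
      star = filter (S ⊆?_) (edges G)

    -- Each edge through `S` goes to its vertex outside `S`; this is injective on positions because
    -- the list of edges has no repetitions.
    codegree≤∣nbhd∣ : codegree G S ≤ ∣ nbhd G S ∣
    codegree≤∣nbhd∣ with enumerate (nbhd G S)
    ... | f , _ , _ , sur = injective⇒≤ {f = λ j → proj₁ (sur (apex∈ j))} inj
      where
      edge : ∀ j → Edge G (lookup star j) × S ⊆ lookup star j
      edge j = let e∈ , S⊆e = ∈-filter⁻ (S ⊆?_) {xs = edges G} (∈-lookup {xs = star} j) in ∈-edges⁻ G e∈ , S⊆e
      apex : ∀ j → ∃ λ x → ⁅ x ⁆ ∪ S ≡ lookup star j
      apex j = superedge⇒insert G ∣S∣≡k (proj₁ (edge j)) (proj₂ (edge j))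
      apex∈ : ∀ j → proj₁ (apex j) ∈ nbhd G S
      apex∈ j = ∈⟦⟧⁺ N? (subst (Edge G) (sym (proj₂ (apex j))) (proj₁ (edge j)))
      inj : ∀ {i j} → proj₁ (sur (apex∈ i)) ≡ proj₁ (sur (apex∈ j)) → i ≡ j
      inj {i} {j} eq = unique⇒lookup-injective
        (Unique.filter⁺ (S ⊆?_) (Unique.filter⁺ (edge? G) (allSubsets-unique n)))
        (trans (sym (proj₂ (apex i))) (trans (cong (λ x → ⁅ x ⁆ ∪ S)
          (trans (sym (proj₂ (sur (apex∈ i)))) (trans (cong f eq) (proj₂ (sur (apex∈ j))))))
          (proj₂ (apex j))))

    -- Conversely, `x` goes to the position of `⁅ x ⁆ ∪ S`; as `x` is outside `S`, the edge
    -- determines `x`.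
    ∣nbhd∣≤codegree : ∣ nbhd G S ∣ ≤ codegree G S
    ∣nbhd∣≤codegree = ∣p∣≤ (nbhd G S) (index ∘ edge∈) inj
      where
      edge∈ : ∀ {x} → x ∈ nbhd G S → ⁅ x ⁆ ∪ S ∈ᴸ star
      edge∈ x∈ = ∈-filter⁺ (S ⊆?_) (∈-edges⁺ G (∈⟦⟧⁻ N? x∈)) (x∈p∪q⁺ ∘ inj₂)
      inj : ∀ {x y} (x∈ : x ∈ nbhd G S) (y∈ : y ∈ nbhd G S) → index (edge∈ x∈) ≡ index (edge∈ y∈) → x ≡ y
      inj {x} {y} x∈ y∈ eq =
        [ x∈⁅y⁆⇒x≡y y , (λ x∈S → contradiction x∈S (insert-edge⇒∉ G ∣S∣≡k (∈⟦⟧⁻ N? x∈))) ]′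
        (x∈p∪q⁻ ⁅ y ⁆ S (subst (x ∈_) xS≡yS (x∈⁅x⁆∪p x S)))
        where
        xS≡yS : ⁅ x ⁆ ∪ S ≡ ⁅ y ⁆ ∪ S
        xS≡yS = trans (lookup-index (edge∈ x∈)) (trans (cong (lookup star) eq) (sym (lookup-index (edge∈ y∈))))

minimum≤ : ∀ {v xs} → v ∈ᴸ xs → minimum xs ≤ v
minimum≤ {xs = x ∷ xs} (here refl) = min≤⊤ x xs
minimum≤ {xs = x ∷ xs} (there v∈)  = All.lookup (min≤xs x xs) v∈

-- A member must be given, because `minimum` of the empty list is 0.
≤minimum : ∀ {v y xs} → y ∈ᴸ xs → (∀ {x} → x ∈ᴸ xs → v ≤ x) → v ≤ minimum xs
≤minimum {xs = x ∷ xs} _ v≤ = v≤min⁺ (v≤ (here refl)) (All.tabulate (v≤ ∘ there))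

δ⁺≤∣nbhd∣ : (G : KGraph (suc k) n) {S : Subset n} {u : Fin n} →
             ∣ S ∣ ≡ k → Edge G (⁅ u ⁆ ∪ S) → δ⁺ G ≤ ∣ nbhd G S ∣
δ⁺≤∣nbhd∣ G ∣S∣≡k e =
  ≤-trans (minimum≤ (∈-map⁺ (codegree G) (∈-shadow⁺ G ∣S∣≡k e))) (codegree≤∣nbhd∣ G ∣S∣≡k)

≤δ⁺ : (G : KGraph (suc k) n) {v : ℕ} → ∃ (Edge G) →
      (∀ {S u} → ∣ S ∣ ≡ k → Edge G (⁅ u ⁆ ∪ S) → v ≤ ∣ nbhd G S ∣) → v ≤ δ⁺ G
≤δ⁺ G {v} (e , e∈G) bound with edge-nonempty G e∈G
... | u , u∈e with edge⇒insert G e∈G u∈e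
...   | S , refl , _ , ∣S∣≡k = ≤minimum (∈-map⁺ (codegree G) (∈-shadow⁺ G ∣S∣≡k e∈G)) all≥
  where
  all≥ : ∀ {x} → x ∈ᴸ map (codegree G) (shadow G) → v ≤ x
  all≥ x∈ with ∈-map⁻ (codegree G) x∈
  ... | T , T∈ , refl with ∈-shadow⁻ G T∈
  ...   | ∣T∣≡k , u , e = ≤-trans (bound ∣T∣≡k e) (∣nbhd∣≤codegree G ∣T∣≡k)

0<δ⁺⇒edge : (G : KGraph (suc k) n) → 0 < δ⁺ G → ∃ (Edge G)
-- An empty shadow would give `δ⁺ G` the default value 0, against `lt`.
0<δ⁺⇒edge G lt with shadow G in eq
... | S ∷ _ with ∈-shadow⁻ G (subst (S ∈ᴸ_) (sym eq) (here refl))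
...   | _ , u , e = ⁅ u ⁆ ∪ S , e

δ⁺≤n : (G : KGraph (suc k) n) → δ⁺ G ≤ n
δ⁺≤n {n = n} G with 0 <? δ⁺ G
... | no  ≮  = ≤-trans (≮⇒≥ ≮) z≤n
... | yes lt with 0<δ⁺⇒edge G lt
...   | e , e∈G with edge-nonempty G e∈G
...     | u , u∈e with edge⇒insert G e∈G u∈e
...       | S , refl , _ , ∣S∣≡k = ≤-trans (δ⁺≤∣nbhd∣ G ∣S∣≡k e∈G) (∣p∣≤n (nbhd G S))

-- With `d = n ∸ δ⁺ G`, failure of the inequality amounts to `suc r * d + C < n`, so the whole
-- vertex set is large enough to force a copy of `F`.
δ⁺-upper : ∀ {r C} (F : KGraph (suc k) m) → Forced F (suc r) C →
           (G : KGraph (suc k) n) → F Free G → suc r * δ⁺ G ≤ r * n + C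
δ⁺-upper {n = n} {r} {C} F forced G free with suc r * δ⁺ G ≤? r * n + C
... | yes le = le
... | no  ≰  = contradiction (let f , copy , _ = forced G deficiency (0<δ⁺⇒edge G 0<δ) ⊤ big in f , copy) free
  where
  δ = δ⁺ G
  d = n ∸ δ
  deficiency : Deficiency≤ G d
  deficiency {S} ∣S∣≡k e = ≤-trans (≤-reflexive (∣∁p∣≡n∸∣p∣ (nbhd G S))) (∸-monoʳ-≤ n (δ⁺≤∣nbhd∣ G ∣S∣≡k e))
  -- If `δ` were 0, the inequality would hold trivially. Positivity supplies the edge that `Forced`
  -- asks for.
  0<δ : 0 < δ
  0<δ = n≢0⇒n>0 λ eq → ≰ (≤-trans (≤-reflexive (trans (cong (suc r *_) eq) (*-zeroʳ r))) z≤n)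
  big : suc r * d + C < ∣ ⊤ {n} ∣
  big = +-cancelʳ-< (suc r * δ) _ _ (begin-strict
    suc r * d + C + suc r * δ   ≡⟨ solve 4 (λ r d C δ → r :* d :+ C :+ r :* δ := r :* (d :+ δ) :+ C)
                                     refl (suc r) d C δ ⟩
    suc r * (d + δ) + C         ≡⟨ cong (λ t → suc r * t + C) (m∸n+n≡m (δ⁺≤n G)) ⟩
    n + r * n + C               ≡⟨ +-assoc n (r * n) C ⟩
    n + (r * n + C)             <⟨ +-monoʳ-< n (≰⇒> ≰) ⟩
    n + suc r * δ               ≡⟨ cong (_+ suc r * δ) (sym (∣⊤∣≡n n)) ⟩
    ∣ ⊤ {n} ∣ + suc r * δ        ∎)
    where
    open ≤-Reasoning
    open +-*-Solver

-- Balanced partite k-graphs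

partite : ∀ {r} k → (Fin n → Fin r) → KGraph k n
partite k c = record
  { Edge    = λ e → ∣ e ∣ ≡ k × ∃₂ λ x y → x ∈ e × y ∈ e × c x ≢ c y
  ; edge?   = λ e → (∣ e ∣ ≟ k) ×-dec any? λ x → any? λ y →
      (x ∈? e) ×-dec ((y ∈? e) ×-dec ¬? (c x ≟ᶠ c y))
  ; uniform = proj₁
  }

-- A copy of `F` would pull `c` back to a proper colouring of `F`.
notColourable⇒partite-free : ∀ {r} (F : KGraph k m) (c : Fin n → Fin r) →
                               ¬ Colourable r F → F Free partite k c
notColourable⇒partite-free F c ¬col (f , _ , f-edge) = ¬col (c ∘ f , proper)
  where
  proper : ∀ {e} → Edge F e → ¬ Monochromatic (c ∘ f) e
  proper e∈F mono with f-edge e∈F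
  ... | _ , x , y , x∈ , y∈ , cx≢cy with ∈-image⁻ f _ x∈ | ∈-image⁻ f _ y∈
  ...   | _ , x∈e , refl | _ , y∈e , refl = cx≢cy (mono x∈e y∈e)

superset-of-size : (p : Subset n) → ∀ j → ∣ p ∣ + j ≤ n → ∃ λ q → p ⊆ q × ∣ q ∣ ≡ ∣ p ∣ + j
superset-of-size p zero    _  = p , id , sym (+-identityʳ _)
superset-of-size {n} p (suc j) le with superset-of-size p j (≤-trans (+-monoʳ-≤ ∣ p ∣ (n≤1+n j)) le)
... | q , p⊆q , ∣q∣ with ∣p∣<∣q∣⇒∃∈q∉p {p = q} {⊤}
        (subst₂ _<_ (sym ∣q∣) (sym (∣⊤∣≡n n)) (≤-trans (≤-reflexive (sym (+-suc ∣ p ∣ j))) le))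
...   | x , _ , x∉q = ⁅ x ⁆ ∪ q , x∈p∪q⁺ ∘ inj₂ ∘ p⊆q ,
        trans (∣insert∣ x∉q ∣q∣) (sym (+-suc ∣ p ∣ j))

module _ {r q} (c : Fin n → Fin r) (class≤q : ∀ i → ∣ ⟦ (λ x → c x ≟ᶠ i) ⟧ ∣ ≤ q) where

  private
    G : KGraph (suc (suc k)) n
    G {k} = partite (suc (suc k)) c

  -- Fix `s` in `S`: a vertex outside `S` coloured differently from `s` is a neighbour, so all
  -- others lie in `S` or in the class of `s`.
  partite-nbhd : ∀ {S} → ∣ S ∣ ≡ suc k → n ∸ (suc k + q) ≤ ∣ nbhd (G {k}) S ∣
  partite-nbhd {k} {S} ∣S∣≡ with ∣p∣>0⇒Nonempty {p = S} (subst (0 <_) (sym ∣S∣≡) (s≤s z≤n))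
  ... | s , s∈S = m≤n+o⇒m∸n≤o n (suc k + q) (begin
      n                                      ≡⟨ sym (∣⊤∣≡n n) ⟩
      ∣ ⊤ {n} ∣                               ≤⟨ p⊆q⇒∣p∣≤∣q∣ cover ⟩
      ∣ (S ∪ class) ∪ nbhd G S ∣              ≤⟨ ∣p∪q∣≤∣p∣+∣q∣ (S ∪ class) _ ⟩
      ∣ S ∪ class ∣ + ∣ nbhd G S ∣             ≤⟨ +-monoˡ-≤ _ (≤-trans (∣p∪q∣≤∣p∣+∣q∣ S class)
                                                  (+-mono-≤ (≤-reflexive ∣S∣≡) (class≤q (c s)))) ⟩
      suc k + q + ∣ nbhd G S ∣                ∎)
    where
    open ≤-Reasoning
    class = ⟦ (λ x → c x ≟ᶠ c s) ⟧
    cover : ⊤ ⊆ (S ∪ class) ∪ nbhd G S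
    cover {x} _ with x ∈? S | c x ≟ᶠ c s
    ... | yes x∈S | _       = x∈p∪q⁺ (inj₁ (x∈p∪q⁺ (inj₁ x∈S)))
    ... | no _    | yes eq  = x∈p∪q⁺ (inj₁ (x∈p∪q⁺ (inj₂ (∈⟦⟧⁺ (λ x → c x ≟ᶠ c s) eq))))
    ... | no x∉S  | no  neq = x∈p∪q⁺ (inj₂ (∈⟦⟧⁺ (λ x → edge? G (⁅ x ⁆ ∪ S))
      (∣insert∣ x∉S ∣S∣≡ , x , s , x∈⁅x⁆∪p x S , x∈p∪q⁺ (inj₂ s∈S) , neq)))

  -- No colour class contains every vertex, so two vertices differ in colour; any set of the right
  -- size containing both is an edge.
  partite-edge : suc k + q < n → ∃ (Edge (G {k}))
  partite-edge {k} lt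
    with ∣p∣<∣q∣⇒∃∈q∉p {p = ⟦ (λ x → c x ≟ᶠ c s) ⟧} {⊤}
           (subst (∣ ⟦ (λ x → c x ≟ᶠ c s) ⟧ ∣ <_) (sym (∣⊤∣≡n n))
             (≤-<-trans (≤-trans (class≤q (c s)) (m≤n+m q (suc k))) lt))
    where
    s : Fin n
    s = fromℕ< lt
  ... | x , _ , x∉ = spanned (superset-of-size xs k
          (≤-trans (≤-reflexive (cong (_+ k) ∣xs∣≡2)) (≤-trans (s≤s (m≤m+n (suc k) q)) lt)))
    where
    s : Fin n
    s = fromℕ< lt
    xs = ⁅ x ⁆ ∪ ⁅ s ⁆
    cx≢cs : c x ≢ c s
    cx≢cs = x∉ ∘ ∈⟦⟧⁺ (λ x → c x ≟ᶠ c s)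
    ∣xs∣≡2 : ∣ xs ∣ ≡ 2
    ∣xs∣≡2 = ∣insert∣ (λ x∈ → cx≢cs (cong c (x∈⁅y⁆⇒x≡y s x∈))) (∣⁅x⁆∣≡1 s)
    spanned : (∃ λ e → xs ⊆ e × ∣ e ∣ ≡ ∣ xs ∣ + k) → ∃ (Edge (G {k}))
    spanned (e , xs⊆e , ∣e∣) = e , trans ∣e∣ (cong (_+ k) ∣xs∣≡2) ,
      x , s , xs⊆e (x∈⁅x⁆∪p x ⁅ s ⁆) , xs⊆e (x∈p∪q⁺ (inj₂ (x∈⁅x⁆ s))) , cx≢cs

  partite-δ⁺ : n ≤ δ⁺ (G {k}) + (suc k + q)
  partite-δ⁺ {k} with suc k + q <? n
  -- For such small `n` there may be no edges, but the summand `suc k + q` already covers `n`.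
  ... | no  ≮  = ≤-trans (≮⇒≥ ≮) (m≤n+m _ _)
  ... | yes lt = begin
      n                                          ≤⟨ m≤n+m∸n n (suc k + q) ⟩
      (suc k + q) + (n ∸ (suc k + q))            ≤⟨ +-monoʳ-≤ (suc k + q) n-k-q≤δ⁺ ⟩
      (suc k + q) + δ⁺ (G {k})                   ≡⟨ +-comm (suc k + q) (δ⁺ G) ⟩
      δ⁺ (G {k}) + (suc k + q)                   ∎
    where
    open ≤-Reasoning
    n-k-q≤δ⁺ : n ∸ (suc k + q) ≤ δ⁺ (G {k})
    n-k-q≤δ⁺ = ≤δ⁺ G (partite-edge lt) λ {S} ∣S∣≡ _ → partite-nbhd {S = S} ∣S∣≡

-- The vertices are placed in a grid of `r` rows and `q` columns and coloured by row; on a colour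
-- class the column is injective.
balanced-colouring : ∀ {r q} → n ≤ r * q → ∃ λ (c : Fin n → Fin r) → ∀ i → ∣ ⟦ (λ x → c x ≟ᶠ i) ⟧ ∣ ≤ q
balanced-colouring {n} {r} {q} le = c , λ i → ∣p∣≤ _ (λ {x} _ → proj₂ (split x)) λ x∈ y∈ eq →
    inject≤-injective le le _ _
      (split-injective (trans (∈⟦⟧⁻ (λ x → c x ≟ᶠ i) x∈) (sym (∈⟦⟧⁻ (λ x → c x ≟ᶠ i) y∈))) eq)
  where
  split : Fin n → Fin r × Fin q
  split x = remQuot q (inject≤ x le)
  c : Fin n → Fin r
  c x = proj₁ (split x)
  split-injective : ∀ {x y} → c x ≡ c y → proj₂ (split x) ≡ proj₂ (split y) → inject≤ x le ≡ inject≤ y le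
  split-injective eq₁ eq₂ = trans (sym (combine-remQuot {r} q _))
    (trans (cong₂ combine eq₁ eq₂) (combine-remQuot {r} q _))

δ⁺-lower : ∀ {r} (F : KGraph (suc (suc k)) m) → ¬ Colourable (suc r) F → ∀ n →
           ∃ λ (c : Fin n → Fin (suc r)) → F Free partite (suc (suc k)) c ×
             r * n ≤ suc r * δ⁺ (partite (suc (suc k)) c) + suc r * suc (suc k)
δ⁺-lower {k} {r = r} F ¬col n with balanced-colouring n≤
  where
  -- The floor plus one, so that `suc r` classes of size `q` have room for all `n` vertices whatever
  -- the remainder.
  q = suc (n /ℕ suc r)
  n≤ : n ≤ suc r * q
  n≤ = begin
    n                                    ≡⟨ m≡m%n+[m/n]*n n (suc r) ⟩
    n % suc r + n /ℕ suc r * suc r        ≤⟨ +-monoˡ-≤ _ (<⇒≤ (m%n<n n (suc r))) ⟩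
    suc r + n /ℕ suc r * suc r            ≡⟨ *-comm q (suc r) ⟩
    suc r * q                            ∎
    where open ≤-Reasoning
-- After `n` is added to both sides, it absorbs `suc r` times the floor. The error
-- `suc r * suc (suc k)` comes from the `suc k` vertices of `S` and one for rounding.
... | c , class≤q = c , notColourable⇒partite-free F c ¬col , +-cancelˡ-≤ n _ _ (begin
    n + r * n                                  ≤⟨ *-monoʳ-≤ (suc r) (partite-δ⁺ c class≤q) ⟩
    suc r * (δ + (suc k + suc (n /ℕ suc r)))    ≡⟨ solve 4 (λ r δ k t →
                                                    r :* (δ :+ (k :+ (con 1 :+ t))) :=
                                                    t :* r :+ (r :* δ :+ r :* (con 1 :+ k)))
                                                    refl (suc r) δ (suc k) (n /ℕ suc r) ⟩
    n /ℕ suc r * suc r + _                      ≤⟨ +-monoˡ-≤ _ (≤-trans (m≤n+m _ (n % suc r))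
                                                    (≤-reflexive (sym (m≡m%n+[m/n]*n n (suc r))))) ⟩
    n + _                                      ∎)
  where
  open ≤-Reasoning
  open +-*-Solver
  δ = δ⁺ (partite (suc (suc k)) c)

-- Existence of ex⁺(n,F)

-- `δ⁺` depends on a graph only through the list `edges`, and equivalent predicates select the same
-- list.
δ⁺-cong : (G G′ : KGraph k n) →
          (∀ {e} → Edge G e → Edge G′ e) → (∀ {e} → Edge G′ e → Edge G e) → δ⁺ G ≡ δ⁺ G′
δ⁺-cong {k} {n} G G′ to from = cong δ⁺-edges (filter-≐ (edge? G) (edge? G′) (to , from) (allSubsets n))
  where
  δ⁺-edges : List (Subset n) → ℕ
  δ⁺-edges es = minimum (map (λ S → length (filter (S ⊆?_) es))
    (filter (λ S → (∣ S ∣ ≟ pred k) ×-dec anyL? (S ⊆?_) es) (allSubsets n)))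

isCopy? : (F : KGraph k m) (G : KGraph k n) (f : Fin m → Fin n) → Dec (f IsCopyOf F In G)
isCopy? F G f =
  map′ (λ inj → inj _ _) (λ inj _ _ → inj) (all? λ x → all? λ y → (f x ≟ᶠ f y) →-dec (x ≟ᶠ y)) ×-dec
  -- Preservation of edges is decided by searching for an edge of `F` whose image is not an edge of
  -- `G`.
  map′ (λ none {e} e∈F → decidable-stable (edge? G (image f e)) (λ ∉G → none (e , e∈F , ∉G)))
       (λ edge (e , e∈F , ∉G) → ∉G (edge e∈F))
       (¬? (anySubset? λ e → edge? F e ×-dec ¬? (edge? G (image f e))))

-- Used for maps recovered from their code in a finite type, which agree with the original only
-- pointwise.
isCopy-≗ : (F : KGraph k m) (G : KGraph k n) {f g : Fin m → Fin n} →
           f ≗ g → f IsCopyOf F In G → g IsCopyOf F In G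
isCopy-≗ F G f≗g (inj , edge) =
  (λ eq → inj (trans (f≗g _) (trans eq (sym (f≗g _))))) ,
  λ {e} e∈F → subst (Edge G) (image-cong f≗g e) (edge e∈F)

free? : (F : KGraph k m) (G : KGraph k n) → Dec (F Free G)
free? F G = ¬? (map′ (λ (i , copy) → finToFun i , copy)
  (λ (f , copy) → funToFin f , isCopy-≗ F G (sym ∘ finToFun-funToFin f) copy)
  (any? (isCopy? F G ∘ finToFun)))

-- A k-graph is coded by the positions of its edges in allSubsets n, so ex⁺(n,F) becomes a maximum over
-- a finite search space.
decode : ∀ k → Subset (length (allSubsets n)) → KGraph k n
decode {n} k p = record
  { Edge    = λ e → ∣ e ∣ ≡ k × ∃ λ i → i ∈ p × lookup (allSubsets n) i ≡ e
  ; edge?   = λ e → (∣ e ∣ ≟ k) ×-dec any? λ i → (i ∈? p) ×-dec (lookup (allSubsets n) i ≟ˢ e)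
  ; uniform = proj₁
  }

encode : KGraph k n → Subset (length (allSubsets n))
encode {n = n} G = ⟦ (λ i → edge? G (lookup (allSubsets n) i)) ⟧

module _ (G : KGraph k n) where

  decode-encode⁺ : ∀ {e} → Edge G e → Edge (decode k (encode G)) e
  decode-encode⁺ {e} e∈G = uniform G e∈G , index e∈ ,
    ∈⟦⟧⁺ (λ i → edge? G (lookup (allSubsets n) i)) (subst (Edge G) (lookup-index e∈) e∈G) , sym (lookup-index e∈)
    where e∈ = allSubsets-complete e

  decode-encode⁻ : ∀ {e} → Edge (decode k (encode G)) e → Edge G e
  decode-encode⁻ (_ , i , i∈ , eq) = subst (Edge G) eq (∈⟦⟧⁻ (λ i → edge? G (lookup (allSubsets n) i)) i∈)

-- Descent from the bound `b`: while `P b` fails, `pred b` is a bound as well.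
maximum-exists : {P : ℕ → Set} → Decidable P → ∀ b → ∃ P → (∀ {m} → P m → m ≤ b) →
                 ∃ λ m → P m × (∀ {m′} → P m′ → m′ ≤ m)
maximum-exists {P} P? b (m , pm) bound with P? b
... | yes pb = b , pb , bound
... | no ¬pb with b | bound
...   | zero  | bound′ = contradiction (subst P (n≤0⇒n≡0 (bound′ pm)) pm) ¬pb
...   | suc c | bound′ = maximum-exists P? c (m , pm) λ pm′ →
        ≤-pred (≤∧≢⇒< (bound′ pm′) λ { refl → ¬pb pm′ })

-- The values of `δ⁺` on free graphs form a decidable set, nonempty by `G₀` and bounded by `n`.
ex⁺-exists : (F : KGraph (suc k) m) (G₀ : KGraph (suc k) n) → F Free G₀ → ∃ (IsEx⁺ F n)
ex⁺-exists {k} {n = n} F G₀ free₀ = greatest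
  (maximum-exists P? n (δ⁺ G₀ , attained G₀ free₀) λ { (p , _ , refl) → δ⁺≤n (decode (suc k) p) })
  where
  P : ℕ → Set
  P d = ∃ λ p → F Free decode (suc k) p × δ⁺ (decode {n} (suc k) p) ≡ d
  P? : Decidable P
  P? d = anySubset? λ p → free? F (decode (suc k) p) ×-dec (δ⁺ (decode {n} (suc k) p) ≟ d)
  attained : ∀ G → F Free G → P (δ⁺ G)
  attained G free = encode G ,
    (λ (f , inj , edge) → free (f , inj , decode-encode⁻ G ∘ edge)) ,
    δ⁺-cong (decode (suc k) (encode G)) G (decode-encode⁻ G) (decode-encode⁺ G)
  greatest : (∃ λ m → P m × (∀ {m′} → P m′ → m′ ≤ m)) → ∃ (IsEx⁺ F n)
  greatest (m , (p , free , eq) , max) =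
    m , (decode (suc k) p , free , eq) , λ G free → max (attained G free)

-- The limit

∣m⊖n∣≤ : ∀ {m n c} → m ≤ n + c → n ≤ m + c → ℤ.∣ m ⊖ n ∣ ≤ c
∣m⊖n∣≤ {m} {n} {c} m≤ n≤ with ≤-total m n
... | inj₁ m≤n = ≤-trans (≤-reflexive (trans (cong ℤ.∣_∣ (ℤ.⊖-≤ m≤n)) (ℤ.∣-i∣≡∣i∣ (+ (n ∸ m)))))
                         (m≤n+o⇒m∸n≤o n m n≤)
... | inj₂ n≤m = ≤-trans (≤-reflexive (cong ℤ.∣_∣ (ℤ.⊖-≥ n≤m))) (m≤n+o⇒m∸n≤o m n m≤)

-- The difference has absolute value at most `C` over the product of the two denominators, while `ε`
-- is at least 1 over its own denominator, and `suc b` exceeds `C` times the latter.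
∣a/b-c/d∣< : ∀ a b c d {C} (ε : ℚ) → 0ℚ ℚ.< ε → a * suc d ≤ c * suc b + C → c * suc b ≤ a * suc d + C →
             C * ℚ.↧ₙ ε ≤ b → ℚ.∣ (+ a / suc b) ℚ.- (+ c / suc d) ∣ ℚ.< ε
∣a/b-c/d∣< a b c d {C} ε@(mkℚ +[1+ p ] q _) _ ≤₁ ≤₂ C*q≤b =
  ℚ.toℚᵘ-cancel-< (ℚᵘ.<-respˡ-≃ (ℚᵘ.≃-sym lhs≃) (ℚᵘ.*<*
    (subst₂ ℤ._<_ (ℤ.pos-* ℤ.∣ numerator ∣ (suc q)) (ℤ.pos-* (suc p) _) (ℤ.+<+ cross))))
  where
  numerator : ℤ
  numerator = + a ℤ.* + suc d ℤ.+ (ℤ.- + c) ℤ.* + suc b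
  -- The comparison is moved to unnormalised rationals, where the denominator is explicit:
  -- `d + b * suc d` is `suc b * suc d` minus one.
  lhs≃ : toℚᵘ ℚ.∣ (+ a / suc b) ℚ.- (+ c / suc d) ∣ ℚᵘ.≃
         mkℚᵘ (+ ℤ.∣ numerator ∣) (d + b * suc d)
  lhs≃ = begin
    toℚᵘ ℚ.∣ x ℚ.- y ∣                   ≈⟨ ℚ.toℚᵘ-homo-∣-∣ (x ℚ.- y) ⟩
    ℚᵘ.∣ toℚᵘ (x ℚ.- y) ∣                ≈⟨ ℚᵘ.∣-∣-cong (ℚ.toℚᵘ-homo-+ x (ℚ.- y)) ⟩
    ℚᵘ.∣ toℚᵘ x ℚᵘ.+ toℚᵘ (ℚ.- y) ∣      ≈⟨ ℚᵘ.∣-∣-cong (ℚᵘ.+-cong (ℚ.toℚᵘ-fromℚᵘ (mkℚᵘ (+ a) b)) -y≃) ⟩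
    mkℚᵘ (+ ℤ.∣ numerator ∣) (d + b * suc d) ∎
    where
    open import Relation.Binary.Reasoning.Setoid ℚᵘ.≃-setoid
    x = + a / suc b
    y = + c / suc d
    -y≃ : toℚᵘ (ℚ.- y) ℚᵘ.≃ ℚᵘ.- mkℚᵘ (+ c) d
    -y≃ = ℚᵘ.≃-trans (ℚ.toℚᵘ-homo‿- y) (ℚᵘ.-‿cong (ℚ.toℚᵘ-fromℚᵘ (mkℚᵘ (+ c) d)))
  ∣numerator∣≤C : ℤ.∣ numerator ∣ ≤ C
  ∣numerator∣≤C = subst (λ i → ℤ.∣ i ∣ ≤ C) (sym eq) (∣m⊖n∣≤ ≤₁ ≤₂)
    where
    eq : numerator ≡ (a * suc d) ⊖ (c * suc b)
    eq = trans (cong₂ ℤ._+_ (sym (ℤ.pos-* a (suc d)))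
                 (trans (sym (ℤ.neg-distribˡ-* (+ c) (+ suc b))) (cong ℤ.-_ (sym (ℤ.pos-* c (suc b))))))
               (ℤ.m-n≡m⊖n (a * suc d) (c * suc b))
  cross : ℤ.∣ numerator ∣ * suc q < suc p * suc (d + b * suc d)
  cross = begin-strict
    ℤ.∣ numerator ∣ * suc q         ≤⟨ *-monoˡ-≤ (suc q) ∣numerator∣≤C ⟩
    C * suc q                      ≤⟨ C*q≤b ⟩
    b                              <⟨ n<1+n b ⟩
    suc b                          ≤⟨ m≤m*n (suc b) (suc d) ⟩
    suc b * suc d                  ≤⟨ m≤m+n _ (p * suc (d + b * suc d)) ⟩
    suc p * suc (d + b * suc d)    ∎
    where open ≤-Reasoning
∣a/b-c/d∣< a b c d (mkℚ (+ 0) _ _)    (ℚ.*<* (ℤ.+<+ ()))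
∣a/b-c/d∣< a b c d (mkℚ -[1+ _ ] _ _) (ℚ.*<* ())

γ⁺-from-bounds : ∀ {r C C′} (F : KGraph (suc k) m) →
  (∀ n (G : KGraph (suc k) n) → F Free G → suc r * δ⁺ G ≤ r * n + C) →
  (∀ n → Σ (KGraph (suc k) n) λ G → F Free G × r * n ≤ suc r * δ⁺ G + C′) →
  γ⁺ F Is (+ r / suc r)
γ⁺-from-bounds {k = k} {r = r} {C} {C′} F above below =
  bounded λ n → let G , free , _ = below n in ex⁺-exists F G free
  where
  bounded : (∀ n → ∃ (IsEx⁺ F n)) → γ⁺ F Is (+ r / suc r)
  bounded ex = proj₁ ∘ ex , proj₂ ∘ ex , limit
    where
    upper : ∀ n → suc r * proj₁ (ex n) ≤ r * n + C
    upper n = let _ , (G , free , eq) , _ = ex n in subst (λ δ → suc r * δ ≤ r * n + C) eq (above n G free)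
    lower : ∀ n → r * n ≤ suc r * proj₁ (ex n) + C′
    lower n = let G , free , le = below n in
      ≤-trans le (+-monoˡ-≤ C′ (*-monoʳ-≤ (suc r) (proj₂ (proj₂ (ex n)) G free)))
    limit : (λ n → + proj₁ (ex (suc n)) / suc n) ⟶ (+ r / suc r)
    -- `C + C′` dominates the errors of both bounds, and is multiplied by the denominator of `ε`.
    -- Index `n` stands for `suc n` vertices.
    limit ε 0<ε = (C + C′) * ℚ.↧ₙ ε , λ n N≤n → ∣a/b-c/d∣< (proj₁ (ex (suc n))) n r r ε 0<ε
      (≤-trans (≤-reflexive (*-comm _ (suc r))) (≤-trans (upper (suc n)) (+-monoʳ-≤ (r * suc n) (m≤m+n C C′))))
      (≤-trans (lower (suc n)) (+-mono-≤ (≤-reflexive (*-comm (suc r) _)) (m≤n+m C′ C)))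
      N≤n

corollary4 : ∀ (r k : ℕ) .{{_ : NonZero r}} .{{_ : NonTrivial k}} →
    (γ⁺ (proj₂ H[ r , k ]) Is (+ pred r / r)) × ¬ Colourable r (proj₂ H[ r , k ])
corollary4 (suc r) (suc (suc k)) =
  γ⁺-from-bounds {r = r} {C = proj₁ (H-forced r k)} H (λ n → δ⁺-upper {r = r} H (proj₂ (H-forced r k)))
    (λ n → let c , free , le = δ⁺-lower {r = r} H (H-notColourable r k) n in partite _ c , free , le) ,
  H-notColourable r k
  where H = proj₂ H[ suc r , suc (suc k) ]
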